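{- For every $n\ge0$ there exists a bijection between staircase tableaux of size $n$ containing no $\delta$ and perfect matchings of $\{1,\dots,2n+2\}$ such that a tableau in which exactly $j$ empty boxes are assigned $q$, exactly $k$ boxes contain $\alpha$ and exactly $\ell$ boxes contain $\gamma$ is sent to a matching whose total number of f-crossings (summed over all edges) is $j$, which has exactly $k$ nested edges, and exactly $\ell$ crossed edges.
   Context: A staircase tableau of size $n$ is a filling of the Young diagram of staircase shape $(n,n-1,\dots,1)$ (English convention: row $r$ consists of columns $1,\dots,n+1-r$; the diagonal boxes are the last boxes of the rows) in which each box is empty or labeled by one of $\alpha,\beta,\gamma,\delta$, such that: no diagonal box is empty; every box in the same row and to the left of a $\beta$ or a $\delta$ is empty; every box in the same column and above an $\alpha$ or a $\gamma$ is empty. Each empty box is assigned $q$ or $1$ according to the nearest labeled box to its right in its row and the nearest labeled box below it in its column: it gets $1$ if it sees a $\beta$ to its right; $q$ if it sees a $\delta$ to its right; $1$ if it sees an $\alpha$ or $\gamma$ to its right and an $\alpha$ or $\delta$ below it; $q$ if it sees an $\alpha$ or $\gamma$ to its right and a $\beta$ or $\gamma$ below it. A perfect matching of $\{1,\dots,2n+2\}$ is a set of $n+1$ pairwise disjoint edges $(i,j)$ with $1\le i<j\le 2n+2$. For an edge $e=(i,j)$, $\mathrm{cross}(e)$ is the number of edges $(l,k)$ with $i<l<j<k$, and $\mathrm{nest}(e)$ is the number of edges $(l,k)$ with $l<i<j<k$. The f-crossing of $e$ is $\mathrm{cross}(e)$ if $\mathrm{nest}(e)>0$, and $\lfloor \mathrm{cross}(e)/2\rfloor$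 otherwise. An edge is nested if $\mathrm{cross}(e)<\mathrm{nest}(e)$ and crossed if $\mathrm{cross}(e)>\mathrm{nest}(e)$. -}

module Defs where

open import Data.Bool using (Bool; true; false; _∧_; _∨_; not; if_then_else_; T)
open import Data.Nat using (ℕ; zero; suc; _+_; _<ᵇ_; _≡ᵇ_; ⌊_/2⌋)
open import Data.Fin using (Fin; toℕ)
open import Data.List using (List; []; _∷_; allFin; map; drop; foldr)
open import Data.Nat.ListAction using (sum)
open import Data.Vec using (Vec; lookup; toList)
open import Data.Maybe using (Maybe; just; nothing)
open import Data.Product using (Σ)

allF : ∀ {m} → (Fin m → Bool) → Bool
allF {m} p = foldr (λ i b → p i ∧ b) true (allFin m)

countF : ∀ {m} → (Fin m → Bool) → ℕ
countF {m} p = sum (map (λ i → if p i then 1 else 0) (allFin m))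

_<F_ : ∀ {m} → Fin m → Fin m → Bool
i <F j = toℕ i <ᵇ toℕ j

data Cell : Set where
  ○ α β γ δ : Cell

isEmpty : Cell → Bool
isEmpty ○ = true
isEmpty _ = false

isβδ : Cell → Bool
isβδ β = true
isβδ δ = true
isβδ _ = false

isαγ : Cell → Bool
isαγ α = true
isαγ γ = true
isαγ _ = false

isα : Cell → Bool
isα α = true
isα _ = false

isγ : Cell → Bool
isγ γ = true
isγ _ = false

isδ : Cell → Bool
isδ δ = true
isδ _ = false

-- A filling of the n×n square grid; entry (r , c) is row r, column c
-- (0-based, English convention).  The staircase shape (n, n-1, …, 1) is
-- the set of boxes with r + c < n; the diagonal boxes are r + c = n - 1.
-- Boxes outside the staircase shape are required to be ○ (canonical padding).
Filling : ℕ → Set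
Filling n = Vec (Vec Cell n) n

cell : ∀ {n} → Filling n → Fin n → Fin n → Cell
cell t r c = lookup (lookup t r) c

inShape : ∀ {n} → Fin n → Fin n → Bool
inShape {n} r c = (toℕ r + toℕ c) <ᵇ n

isDiag : ∀ {n} → Fin n → Fin n → Bool
isDiag {n} r c = suc (toℕ r + toℕ c) ≡ᵇ n

_⇒ᵇ_ : Bool → Bool → Bool
a ⇒ᵇ b = not a ∨ b

isStaircase : ∀ {n} → Filling n → Bool
isStaircase t =
  allF (λ r → allF (λ c → not (inShape r c) ⇒ᵇ isEmpty (cell t r c)))
  ∧ allF (λ r → allF (λ c → isDiag r c ⇒ᵇ not (isEmpty (cell t r c))))
  ∧ allF (λ r → allF (λ c → allF (λ c' →
        (isβδ (cell t r c) ∧ (c' <F c)) ⇒ᵇ isEmpty (cell t r c'))))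
  ∧ allF (λ r → allF (λ c → allF (λ r' →
        (isαγ (cell t r c) ∧ (r' <F r)) ⇒ᵇ isEmpty (cell t r' c))))

StaircaseTableau : ℕ → Set
StaircaseTableau n = Σ (Filling n) (λ t → T (isStaircase t))

noDelta : ∀ {n} → Filling n → Bool
noDelta t = allF (λ r → allF (λ c → not (isδ (cell t r c))))

NoDeltaTableau : ℕ → Set
NoDeltaTableau n = Σ (Filling n) (λ t → T (isStaircase t ∧ noDelta t))

firstLabel : List Cell → Maybe Cell
firstLabel [] = nothing
firstLabel (○ ∷ xs) = firstLabel xs
firstLabel (x ∷ xs) = just x

seeRight : ∀ {n} → Filling n → Fin n → Fin n → Maybe Cell
seeRight t r c = firstLabel (drop (suc (toℕ c)) (toList (lookup t r)))

seeBelow : ∀ {n} → Filling n → Fin n → Fin n → Maybe Cell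
seeBelow t r c = firstLabel (drop (suc (toℕ r)) (toList (Data.Vec.map (λ row → lookup row c) t)))

weightIsQ : Maybe Cell → Maybe Cell → Bool
weightIsQ (just β) _ = false
weightIsQ (just δ) _ = true
weightIsQ (just α) (just β) = true
weightIsQ (just α) (just γ) = true
weightIsQ (just γ) (just β) = true
weightIsQ (just γ) (just γ) = true
weightIsQ _ _ = false

qCount : ∀ {n} → Filling n → ℕ
qCount t = sum (map (λ r → countF (λ c →
  inShape r c ∧ isEmpty (cell t r c) ∧ weightIsQ (seeRight t r c) (seeBelow t r c))) (allFin _))

alphaCount : ∀ {n} → Filling n → ℕ
alphaCount t = sum (map (λ r → countF (λ c → isα (cell t r c))) (allFin _))

gammaCount : ∀ {n} → Filling n → ℕ
gammaCount t = sum (map (λ r → countF (λ c → isγ (cell t r c))) (allFin _))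

-- Perfect matchings of {1,…,m} (represented 0-based on Fin m) as the
-- partner vector: p[i] is the point matched with i.  Edges are the pairs
-- (i , p[i]) with i < p[i].

Partner : ℕ → Set
Partner m = Vec (Fin m) m

_≡F_ : ∀ {m} → Fin m → Fin m → Bool
i ≡F j = toℕ i ≡ᵇ toℕ j

isPerfectMatching : ∀ {m} → Partner m → Bool
isPerfectMatching p =
  allF (λ i → (lookup p (lookup p i) ≡F i) ∧ not (lookup p i ≡F i))

PerfectMatching : ℕ → Set
PerfectMatching m = Σ (Partner m) (λ p → T (isPerfectMatching p))

-- cross of the edge with left endpoint i (right endpoint j = p[i]):
-- number of edges (l , k) with i < l < j < k
crossAt : ∀ {m} → Partner m → Fin m → ℕ
crossAt p i = countF (λ l → (i <F l) ∧ (l <F lookup p i) ∧ (lookup p i <F lookup p l))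

nestAt : ∀ {m} → Partner m → Fin m → ℕ
nestAt p i = countF (λ l → (l <F i) ∧ (lookup p i <F lookup p l))

isLeftEnd : ∀ {m} → Partner m → Fin m → Bool
isLeftEnd p i = i <F lookup p i

fcrossAt : ∀ {m} → Partner m → Fin m → ℕ
fcrossAt p i = if 0 <ᵇ nestAt p i then crossAt p i else ⌊ crossAt p i /2⌋

totalFCross : ∀ {m} → Partner m → ℕ
totalFCross {m} p = sum (map (λ i → if isLeftEnd p i then fcrossAt p i else 0) (allFin m))

nestedEdges : ∀ {m} → Partner m → ℕ
nestedEdges p = countF (λ i → isLeftEnd p i ∧ (crossAt p i <ᵇ nestAt p i))

crossedEdges : ∀ {m} → Partner m → ℕ
crossedEdges p = countF (λ i → isLeftEnd p i ∧ (nestAt p i <ᵇ crossAt p i))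

{-# OPTIONS --safe #-}
module Submission where

-- Both sides are instances of one identity, valid in every commutative semiring and proved without
-- subtraction; applied to the semiring of weighted sets up to weight-preserving bijection it
-- becomes the bijection sought.
--
-- Matchings, read from left to right, are Dyck paths in which a down step from height h chooses one
-- of h open edges, its crossings c and nestings d satisfying c + d = h - 1.  With [m] = 1 + q + … + q^(m-1),
-- the choices weigh q^m + [m](α + γ q^m) for h = 2m + 1 and [m](α + γ q^(m-1)) for h = 2m.
--
-- Tableaux are read column by column from right to left.  The state is the number k of live rows, those
-- whose leftmost label is α or γ; in the other rows all boxes further left are empty and weigh 1.
-- Writing zᵏ for the state, a new column acts by zᵏ ↦ (1 + γz)(1 + qz)ᵏ + αz(zᵏ + Σ_{i<k} (1 + qz)ⁱ zᵏ⁻¹⁻ⁱ).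
-- Under zᵏ ↦ Yᵏ w₀, where Y wₘ = wₘ₊₁ + [m+1] wₘ, this becomes the tridiagonal operator that adds two
-- steps to a Dyck path at the odd height 2m + 1, up to a rescaling of wₘ.

open import Defs
open import Algebra.Bundles using (CommutativeSemiring)
open import Data.Bool using (Bool; true; false; _∧_; T; if_then_else_; not)
open import Data.Nat as ℕ using (ℕ; zero; suc; _∸_; _<ᵇ_; ⌊_/2⌋)
import Data.Nat.Properties as ℕ
open import Function using (_∘_; id)
import Relation.Binary.PropositionalEquality as ≡

-- Over a ring, wₘ is the product (z - [1])(z - [2]) ... (z - [m]). Since 1 + q[i] = [i+1],
-- replacing z by 1 + qz turns it, for m > 0, into q^m z (z - [1]) ... (z - [m-1]), which is q^m (wₘ
-- + [m] wₘ₋₁). The α-part of a column is αz times p + (p(1 + qz) - p(z)) / (1 + qz - z), and this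
-- expression sends wₘ to wₘ + [m] wₘ₋₁. Hence the q-integers as nodes, and hence a tridiagonal
-- operator. Neither the products nor the quotient can be formed without subtraction. Functionals
-- take their place: a sequence f lists the values f m at wₘ, operators act on such sequences as
-- transposes, and what remains to be checked are two commutation rules with multiplication by z,
-- both free of signs. Sums over tableaux are likewise written against an arbitrary function of the
-- number of live rows. As equality of weighted sets means a bijection, cancelling a common summand
-- or factor is avoided as well.

module Intertwining {c ℓ} (R : CommutativeSemiring c ℓ) (q a g : CommutativeSemiring.Carrier R) where
  open CommutativeSemiring R hiding (zero)
  open import Algebra.Solver.Ring.NaturalCoefficients.Default R using (solve; _:+_; _:*_; _:=_; con)
  open import Relation.Binary.Reasoning.Setoid setoid
  open import Algebra.Properties.CommutativeSemigroup +-commutativeSemigroup using () renaming (interchange to +-interchange)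

  -- O, A and G sum over the columns meeting k live rows whose topmost label is β, α, γ respectively;
  -- h is evaluated at the new number of live rows, and the recursion peels off the top row.
  O A G column : ℕ → (ℕ → Carrier) → Carrier
  O zero h = h 0
  O (suc k) h = O k h + q * O k (h ∘ suc)
  A zero h = a * h 1
  A (suc k) h = A k (h ∘ suc) + a * O k (h ∘ suc)
  G zero h = g * h 1
  G (suc k) h = q * G k (h ∘ suc) + g * O k (h ∘ suc)
  column k h = O k h + (A k h + G k h)

  -- `h` is evaluated at the final number of live rows. The column peeled off is the leftmost, read
  -- last, so its sum becomes the function against which the other columns are summed.
  tab : ℕ → (ℕ → Carrier) → Carrier
  tab zero h = h 0
  tab (suc n) h = tab n (λ k → column k h)

  infixr 8 _^_
  _^_ : Carrier → ℕ → Carrier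
  x ^ zero = 1#
  x ^ suc n = x * x ^ n

  sumTo : ℕ → (ℕ → Carrier) → Carrier
  sumTo zero f = 0#
  sumTo (suc n) f = sumTo n f + f n

  edge : ℕ → ℕ → Carrier
  edge c d = q ^ (if 0 <ᵇ d then c else ⌊ c /2⌋)
    * ((if c <ᵇ d then a else 1#) * (if d <ᵇ c then g else 1#))

  -- The down step from height h + 1: the closed edge meets the h other open edges, c of them as
  -- crossings and h - c as nestings.
  lam : ℕ → Carrier
  lam h = sumTo (suc h) (λ c → edge c (h ∸ c))

  -- Here n is the number of steps left and the second argument the current height; paths end at
  -- height 0.
  dyck : ℕ → ℕ → Carrier
  dyck zero zero = 1#
  dyck zero (suc h) = 0#
  dyck (suc n) zero = dyck n 1
  dyck (suc n) (suc h) = dyck n (suc (suc h)) + lam h * dyck n h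

  double : ℕ → ℕ
  double zero = zero
  double (suc n) = suc (suc (double n))

  sumTo-cong : ∀ n {f f' : ℕ → Carrier} → (∀ i → i ℕ.< n → f i ≈ f' i) → sumTo n f ≈ sumTo n f'
  sumTo-cong zero eq = refl
  sumTo-cong (suc n) eq = +-cong (sumTo-cong n (λ i i<n → eq i (ℕ.m<n⇒m<1+n i<n))) (eq n ℕ.≤-refl)

  sumTo-+ : ∀ m n f → sumTo (m ℕ.+ n) f ≈ sumTo m f + sumTo n (λ i → f (m ℕ.+ i))
  sumTo-+ m zero f rewrite ℕ.+-identityʳ m = sym (+-identityʳ _)
  sumTo-+ m (suc n) f rewrite ℕ.+-suc m n = trans (+-congʳ (sumTo-+ m n f)) (+-assoc _ _ _)

  *-sumTo : ∀ n x f → sumTo n (λ i → x * f i) ≈ x * sumTo n f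
  *-sumTo zero x f = sym (zeroʳ x)
  *-sumTo (suc n) x f = trans (+-congʳ (*-sumTo n x f)) (sym (distribˡ x _ _))

  ^-+ : ∀ x m n → x ^ (m ℕ.+ n) ≈ x ^ m * x ^ n
  ^-+ x zero n = sym (*-identityˡ _)
  ^-+ x (suc m) n = trans (*-congˡ (^-+ x m n)) (sym (*-assoc x _ _))

  -- q-integers and the transposed column operator

  ⟦_⟧ : ℕ → Carrier
  ⟦ n ⟧ = sumTo n (q ^_)

  ⟦⟧-suc : ∀ n → ⟦ suc n ⟧ ≈ 1# + q * ⟦ n ⟧
  ⟦⟧-suc n = trans (sumTo-+ 1 n (q ^_)) (+-cong (+-identityˡ 1#) (*-sumTo n q (q ^_)))

  -- Transposes, in the basis wₘ, of operators on polynomials in z: `Y` of multiplication by z, `S`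
  -- of the substitution of 1 + qz for z, `M` of zᵏ ↦ zᵏ + Σ_{i<k} (1 + qz)ⁱ zᵏ⁻¹⁻ⁱ, and `J` of the
  -- whole column. Transposition reverses products, so `M (Y f)` means: apply the operator of `M`,
  -- multiply by z, then apply `f`.
  Y M S J : (ℕ → Carrier) → ℕ → Carrier
  Y f m = f (suc m) + ⟦ suc m ⟧ * f m
  M f zero = f 0
  M f (suc m) = f (suc m) + ⟦ suc m ⟧ * f m
  S f m = q ^ m * M f m
  J f m = S f m + (a * M (Y f) m + g * S (Y f) m)

  -- The value at zᵏ of the functional whose value at wₘ is `f m`.
  ev : ℕ → (ℕ → Carrier) → Carrier
  ev zero f = f 0
  ev (suc k) f = ev k (Y f)

  Y-cong : ∀ {f f'} → (∀ m → f m ≈ f' m) → ∀ m → Y f m ≈ Y f' m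
  Y-cong eq m = +-cong (eq _) (*-congˡ (eq _))

  M-cong : ∀ {f f'} → (∀ m → f m ≈ f' m) → ∀ m → M f m ≈ M f' m
  M-cong eq zero = eq 0
  M-cong eq (suc m) = +-cong (eq _) (*-congˡ (eq _))

  ev-cong : ∀ k {f f'} → (∀ m → f m ≈ f' m) → ev k f ≈ ev k f'
  ev-cong zero eq = eq 0
  ev-cong (suc k) eq = ev-cong k (Y-cong eq)

  ev-+ : ∀ k f f' → ev k (λ m → f m + f' m) ≈ ev k f + ev k f'
  ev-+ zero f f' = refl
  ev-+ (suc k) f f' = trans
    (ev-cong k (λ m → trans (+-congˡ (distribˡ _ _ _)) (+-interchange _ _ _ _)))
    (ev-+ k (Y f) (Y f'))

  ev-* : ∀ k x f → ev k (λ m → x * f m) ≈ x * ev k f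
  ev-* zero x f = refl
  ev-* (suc k) x f = trans
    (ev-cong k (λ m → solve 4 (λ x u v w → x :* u :+ v :* (x :* w) := x :* (u :+ v :* w)) refl x _ _ _))
    (ev-* k x (Y f))

  ev-*+* : ∀ k x f y f' → ev k (λ m → x * f m + y * f' m) ≈ x * ev k f + y * ev k f'
  ev-*+* k x f y f' = trans (ev-+ k _ _) (+-cong (ev-* k x f) (ev-* k y f'))

  -- Substituting 1 + qz for z in zp(z) gives (1 + qz) p(1 + qz). In coordinates the rule comes from
  -- [m+2] = 1 + q[m+1], applied only to the factor that the outer `Y` contributes: its 1 yields
  -- `S f`, the rest joins `q * S (Y f)`.
  Y-S : ∀ f m → Y (S f) m ≈ S f m + q * S (Y f) m
  Y-S f zero = solve 3 (λ q u v →
    (q :* con 1) :* (v :+ (con 0 :+ con 1) :* u) :+ (con 0 :+ con 1) :* (con 1 :* u)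
    := con 1 :* u :+ q :* (con 1 :* (v :+ (con 0 :+ con 1) :* u))) refl q _ _
  Y-S f (suc m) = begin
    q * p * (w + y * v) + y * (p * (v + x * u))
      ≈⟨ +-congˡ (*-congʳ (⟦⟧-suc (suc m))) ⟩
    q * p * (w + y * v) + (1# + q * x) * (p * (v + x * u))
      ≈⟨ solve 7 (λ q p x y u v w →
           q :* p :* (w :+ y :* v) :+ (con 1 :+ q :* x) :* (p :* (v :+ x :* u))
           := p :* (v :+ x :* u) :+ q :* (p :* ((w :+ y :* v) :+ x :* (v :+ x :* u))))
         refl q p x y u v w ⟩
    p * (v + x * u) + q * (p * ((w + y * v) + x * (v + x * u))) ∎
    where
    p = q ^ suc m
    x = ⟦ suc m ⟧
    y = ⟦ suc (suc m) ⟧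
    u = f m
    v = f (suc m)
    w = f (suc (suc m))

  -- Passing from zᵏ to zᵏ⁺¹ multiplies the sum behind `M` by z and adds one new summand, (1 + qz)ᵏ.
  -- In coordinates this uses the other splitting, [m+2] = [m+1] + q^(m+1), which holds by
  -- definition.
  Y-M : ∀ f m → Y (M f) m ≈ M (Y f) m + S f m
  Y-M f zero = solve 2 (λ u v →
    (v :+ (con 0 :+ con 1) :* u) :+ (con 0 :+ con 1) :* u
    := (v :+ (con 0 :+ con 1) :* u) :+ con 1 :* u) refl _ _
  Y-M f (suc m) = solve 5 (λ p x u v w →
    (w :+ (x :+ p) :* v) :+ (x :+ p) :* (v :+ x :* u)
    := ((w :+ (x :+ p) :* v) :+ x :* (v :+ x :* u)) :+ p :* (v :+ x :* u))
    refl (q ^ suc m) ⟦ suc m ⟧ (f m) (f (suc m)) (f (suc (suc m)))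

  -- Each live row contributes a factor 1 + qz: a new β ends the row, or the box stays empty at the
  -- price q and the row stays live. `Y-S` is this step on the side of functionals.
  O-ev : ∀ k f → O k (λ j → ev j f) ≈ ev k (S f)
  O-ev zero f = sym (*-identityˡ _)
  O-ev (suc k) f = begin
    O k (λ j → ev j f) + q * O k (λ j → ev j (Y f)) ≈⟨ +-cong (O-ev k f) (*-congˡ (O-ev k (Y f))) ⟩
    ev k (S f) + q * ev k (S (Y f))                 ≈⟨ +-congˡ (ev-* k q _) ⟨
    ev k (S f) + ev k (λ m → q * S (Y f) m)         ≈⟨ ev-+ k _ _ ⟨
    ev k (λ m → S f m + q * S (Y f) m)              ≈⟨ ev-cong k (Y-S f) ⟨
    ev k (Y (S f))                                  ∎

  A-ev : ∀ k f → A k (λ j → ev j f) ≈ a * ev k (M (Y f))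
  A-ev zero f = refl
  A-ev (suc k) f = begin
    A k (λ j → ev j (Y f)) + a * O k (λ j → ev j (Y f)) ≈⟨ +-cong (A-ev k (Y f)) (*-congˡ (O-ev k (Y f))) ⟩
    a * ev k (M (Y (Y f))) + a * ev k (S (Y f))         ≈⟨ distribˡ a _ _ ⟨
    a * (ev k (M (Y (Y f))) + ev k (S (Y f)))           ≈⟨ *-congˡ (ev-+ k _ _) ⟨
    a * ev k (λ m → M (Y (Y f)) m + S (Y f) m)          ≈⟨ *-congˡ (ev-cong k (Y-M (Y f))) ⟨
    a * ev k (Y (M (Y f)))                              ∎

  G-ev : ∀ k f → G k (λ j → ev j f) ≈ g * ev k (S (Y f))
  G-ev zero f = *-congˡ (sym (*-identityˡ _))
  G-ev (suc k) f = begin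
    q * G k (λ j → ev j (Y f)) + g * O k (λ j → ev j (Y f)) ≈⟨ +-cong (*-congˡ (G-ev k (Y f))) (*-congˡ (O-ev k (Y f))) ⟩
    q * (g * ev k (S (Y (Y f)))) + g * ev k (S (Y f))       ≈⟨ solve 4 (λ q g u v → q :* (g :* u) :+ g :* v := g :* (v :+ q :* u)) refl q g _ _ ⟩
    g * (ev k (S (Y f)) + q * ev k (S (Y (Y f))))           ≈⟨ *-congˡ (+-congˡ (ev-* k q _)) ⟨
    g * (ev k (S (Y f)) + ev k (λ m → q * S (Y (Y f)) m))   ≈⟨ *-congˡ (ev-+ k _ _) ⟨
    g * ev k (λ m → S (Y f) m + q * S (Y (Y f)) m)          ≈⟨ *-congˡ (ev-cong k (Y-S (Y f))) ⟨
    g * ev k (Y (S (Y f)))                                  ∎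

  column-ev : ∀ k f → column k (λ j → ev j f) ≈ ev k (J f)
  column-ev k f = begin
    column k (λ j → ev j f)
      ≈⟨ +-cong (O-ev k f) (+-cong (A-ev k f) (G-ev k f)) ⟩
    ev k (S f) + (a * ev k (M (Y f)) + g * ev k (S (Y f)))
      ≈⟨ +-congˡ (ev-*+* k a _ g _) ⟨
    ev k (S f) + ev k (λ m → a * M (Y f) m + g * S (Y f) m)
      ≈⟨ ev-+ k _ _ ⟨
    ev k (J f) ∎

  O-cong : ∀ k {h h'} → (∀ j → h j ≈ h' j) → O k h ≈ O k h'
  O-cong zero eq = eq 0
  O-cong (suc k) eq = +-cong (O-cong k eq) (*-congˡ (O-cong k (λ j → eq (suc j))))

  A-cong : ∀ k {h h'} → (∀ j → h j ≈ h' j) → A k h ≈ A k h'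
  A-cong zero eq = *-congˡ (eq 1)
  A-cong (suc k) eq = +-cong (A-cong k (λ j → eq (suc j))) (*-congˡ (O-cong k (λ j → eq (suc j))))

  G-cong : ∀ k {h h'} → (∀ j → h j ≈ h' j) → G k h ≈ G k h'
  G-cong zero eq = *-congˡ (eq 1)
  G-cong (suc k) eq = +-cong (*-congˡ (G-cong k (λ j → eq (suc j)))) (*-congˡ (O-cong k (λ j → eq (suc j))))

  column-cong : ∀ k {h h'} → (∀ j → h j ≈ h' j) → column k h ≈ column k h'
  column-cong k eq = +-cong (O-cong k eq) (+-cong (A-cong k eq) (G-cong k eq))

  tab-cong : ∀ n {h h'} → (∀ j → h j ≈ h' j) → tab n h ≈ tab n h'
  tab-cong zero eq = eq 0
  tab-cong (suc n) eq = tab-cong n (λ k → column-cong k eq)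

  O-+ : ∀ k h h' → O k (λ j → h j + h' j) ≈ O k h + O k h'
  O-+ zero h h' = refl
  O-+ (suc k) h h' = trans
    (+-cong (O-+ k h h') (trans (*-congˡ (O-+ k (h ∘ suc) (h' ∘ suc))) (distribˡ q _ _)))
    (+-interchange _ _ _ _)

  O-* : ∀ k x h → O k (λ j → x * h j) ≈ x * O k h
  O-* zero x h = refl
  O-* (suc k) x h = trans (+-cong (O-* k x h) (*-congˡ (O-* k x (h ∘ suc))))
    (solve 4 (λ q x u v → x :* u :+ q :* (x :* v) := x :* (u :+ q :* v)) refl q x _ _)

  G-* : ∀ k x h → G k (λ j → x * h j) ≈ x * G k h
  G-* zero x h = solve 3 (λ g x u → g :* (x :* u) := x :* (g :* u)) refl g x _
  G-* (suc k) x h = trans (+-cong (*-congˡ (G-* k x (h ∘ suc))) (*-congˡ (O-* k x (h ∘ suc))))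
    (solve 5 (λ q g x u v → q :* (x :* u) :+ g :* (x :* v) := x :* (q :* u :+ g :* v)) refl q g x _ _)

  J^ : ℕ → (ℕ → Carrier) → ℕ → Carrier
  J^ zero f = f
  J^ (suc n) f = J (J^ n f)

  -- Needed because `tab` places the factor of a new column innermost, while `J^` places it
  -- outermost.
  J^-comm : ∀ n f → J^ n (J f) ≡.≡ J (J^ n f)
  J^-comm zero f = ≡.refl
  J^-comm (suc n) f = ≡.cong J (J^-comm n f)

  tab-ev : ∀ n f → tab n (λ j → ev j f) ≈ J^ n f 0
  tab-ev zero f = refl
  tab-ev (suc n) f = trans (tab-cong n (λ k → column-ev k f))
    (trans (tab-ev n (J f)) (reflexive (≡.cong (λ φ → φ 0) (J^-comm n f))))

  -- Evaluation at z = 1: every wₘ with m > 0 contains the factor z - [1] and vanishes there. It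
  -- therefore takes the value 1 at every zᵏ, which forgets the number of live rows.
  δ₀ : ℕ → Carrier
  δ₀ zero = 1#
  δ₀ (suc _) = 0#

  Y-δ₀ : ∀ m → Y δ₀ m ≈ δ₀ m
  Y-δ₀ zero = solve 0 (con 0 :+ (con 0 :+ con 1) :* con 1 := con 1) refl
  Y-δ₀ (suc m) = trans (+-identityˡ _) (zeroʳ _)

  ev-δ₀ : ∀ k → ev k δ₀ ≈ 1#
  ev-δ₀ zero = refl
  ev-δ₀ (suc k) = trans (ev-cong k Y-δ₀) (ev-δ₀ k)

  -- Closed forms of the down-step weights

  <ᵇ-true : ∀ {m n} → m ℕ.< n → (m <ᵇ n) ≡.≡ true
  <ᵇ-true {zero} {suc n} _ = ≡.refl
  <ᵇ-true {suc m} {suc n} (ℕ.s≤s p) = <ᵇ-true p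

  <ᵇ-false : ∀ {m n} → n ℕ.≤ m → (m <ᵇ n) ≡.≡ false
  <ᵇ-false {m} {zero} _ = ≡.refl
  <ᵇ-false {suc m} {suc n} (ℕ.s≤s p) = <ᵇ-false p

  edge-nested : ∀ {c d} → c ℕ.< d → edge c d ≈ a * q ^ c
  edge-nested {c} {d@(suc _)} c<d rewrite <ᵇ-true c<d | <ᵇ-false (ℕ.<⇒≤ c<d) =
    trans (*-congˡ (*-identityʳ a)) (*-comm _ a)

  edge-crossed : ∀ {c d} → 0 ℕ.< d → d ℕ.< c → edge c d ≈ g * q ^ c
  edge-crossed {c} {d@(suc _)} _ d<c rewrite <ᵇ-true d<c | <ᵇ-false (ℕ.<⇒≤ d<c) =
    trans (*-congˡ (*-identityˡ g)) (*-comm _ g)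

  edge-balanced : ∀ c → edge (suc c) (suc c) ≈ q ^ suc c
  edge-balanced c rewrite <ᵇ-false (ℕ.≤-refl {c}) =
    trans (*-congˡ (*-identityˡ 1#)) (*-identityʳ _)

  edge-outer : ∀ c → edge (suc c) 0 ≈ g * q ^ ⌊ suc c /2⌋
  edge-outer c = trans (*-congˡ (*-identityˡ g)) (*-comm _ g)

  double≡+ : ∀ m → double m ≡.≡ m ℕ.+ m
  double≡+ zero = ≡.refl
  double≡+ (suc m) = ≡.cong suc (≡.trans (≡.cong suc (double≡+ m)) (≡.sym (ℕ.+-suc m m)))

  ⌊double/2⌋ : ∀ m → ⌊ double m /2⌋ ≡.≡ m
  ⌊double/2⌋ zero = ≡.refl
  ⌊double/2⌋ (suc m) = ≡.cong suc (⌊double/2⌋ m)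

  ⌊1+double/2⌋ : ∀ m → ⌊ suc (double m) /2⌋ ≡.≡ m
  ⌊1+double/2⌋ zero = ≡.refl
  ⌊1+double/2⌋ (suc m) = ≡.cong suc (⌊1+double/2⌋ m)

  nested-sum : ∀ n h → n ℕ.+ n ℕ.≤ suc h → sumTo n (λ c → edge c (h ∸ c)) ≈ a * ⟦ n ⟧
  nested-sum n h n+n≤1+h = trans (sumTo-cong n step) (*-sumTo n a (q ^_))
    where
    step : ∀ c → c ℕ.< n → edge c (h ∸ c) ≈ a * q ^ c
    step c c<n = edge-nested (ℕ.m+n≤o⇒m≤o∸n (suc c)
      (ℕ.s≤s⁻¹ (ℕ.≤-trans (ℕ.≤-reflexive (≡.sym (ℕ.+-suc (suc c) c)))
        (ℕ.≤-trans (ℕ.+-mono-≤ c<n c<n) n+n≤1+h))))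

  -- The range of crossing numbers s, ..., h - 1 stops before h, where no nesting is left and the
  -- exponent is halved.
  crossed-sum : ∀ s n h → s ℕ.+ n ≡.≡ h → h ℕ.< s ℕ.+ s →
    sumTo n (λ i → edge (s ℕ.+ i) (h ∸ (s ℕ.+ i))) ≈ g * (q ^ s * ⟦ n ⟧)
  crossed-sum s n h ≡.refl h<s+s = begin
    sumTo n (λ i → edge (s ℕ.+ i) (s ℕ.+ n ∸ (s ℕ.+ i))) ≈⟨ sumTo-cong n step ⟩
    sumTo n (λ i → g * (q ^ s * q ^ i))                ≈⟨ *-sumTo n g _ ⟩
    g * sumTo n (λ i → q ^ s * q ^ i)                  ≈⟨ *-congˡ (*-sumTo n (q ^ s) _) ⟩
    g * (q ^ s * ⟦ n ⟧)                                ∎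
    where
    step : ∀ i → i ℕ.< n → edge (s ℕ.+ i) (s ℕ.+ n ∸ (s ℕ.+ i)) ≈ g * (q ^ s * q ^ i)
    step i i<n rewrite ℕ.[m+n]∸[m+o]≡n∸o s n i = trans
      (edge-crossed (ℕ.m<n⇒0<n∸m i<n)
        (ℕ.≤-<-trans (ℕ.m∸n≤m n i) (ℕ.<-≤-trans (ℕ.+-cancelˡ-< s n s h<s+s) (ℕ.m≤m+n s i))))
      (*-congˡ (^-+ q s i))

  -- The values c = m + 1, ..., 2m give γ q^(m+1) [m]. The edge without nesting has c = 2m + 1, and
  -- halving turns its exponent into m: exactly the term that completes the sum to γ q^m [m+1].
  lam-odd : ∀ m → lam (suc (double m)) ≈ ⟦ suc m ⟧ * (a + g * q ^ m)
  lam-odd m = begin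
    sumTo (suc (double m)) f + f h
      ≈⟨ +-cong (reflexive (≡.cong (λ k → sumTo (suc k) f) (double≡+ m))) f-last ⟩
    sumTo (suc m ℕ.+ m) f + g * q ^ m
      ≈⟨ +-congʳ (sumTo-+ (suc m) m f) ⟩
    sumTo (suc m) f + sumTo m (λ i → f (suc m ℕ.+ i)) + g * q ^ m
      ≈⟨ +-congʳ (+-cong
           (nested-sum (suc m) h (ℕ.≤-reflexive (≡.sym (≡.cong suc h≡))))
           (crossed-sum (suc m) m h (≡.cong suc (≡.sym (double≡+ m)))
             (ℕ.≤-reflexive (≡.cong suc h≡)))) ⟩
    a * ⟦ suc m ⟧ + g * (q ^ suc m * ⟦ m ⟧) + g * q ^ m
      ≈⟨ solve 6 (λ a g q p x y →
           a :* y :+ g :* ((q :* p) :* x) :+ g :* p := a :* y :+ (con 1 :+ q :* x) :* (g :* p))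
         refl a g q (q ^ m) ⟦ m ⟧ ⟦ suc m ⟧ ⟩
    a * ⟦ suc m ⟧ + (1# + q * ⟦ m ⟧) * (g * q ^ m)
      ≈⟨ +-cong (*-comm a _) (*-congʳ (sym (⟦⟧-suc m))) ⟩
    ⟦ suc m ⟧ * a + ⟦ suc m ⟧ * (g * q ^ m)
      ≈⟨ distribˡ ⟦ suc m ⟧ _ _ ⟨
    ⟦ suc m ⟧ * (a + g * q ^ m) ∎
    where
    h = suc (double m)
    f = λ c → edge c (h ∸ c)
    h≡ : suc (double m) ≡.≡ m ℕ.+ suc m
    h≡ = ≡.trans (≡.cong suc (double≡+ m)) (≡.sym (ℕ.+-suc m m))
    f-last : f h ≈ g * q ^ m
    f-last rewrite ℕ.n∸n≡0 (double m) = trans (edge-outer (double m))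
      (*-congˡ (reflexive (≡.cong (q ^_) (⌊1+double/2⌋ m))))

  -- For m > 0 the middle value c = m is neither nested nor crossed and gives the bare q^m. Again
  -- halving, now of c = 2m, supplies the lowest term γ q^m missing from the crossed edges.
  lam-even : ∀ m → lam (double m) ≈ q ^ m + ⟦ m ⟧ * (a + g * q ^ m)
  lam-even zero = solve 2 (λ a g →
    con 0 :+ con 1 :* (con 1 :* con 1) := con 1 :+ con 0 :* (a :+ g :* con 1)) refl a g
  lam-even m@(suc m-1) = begin
    sumTo (double m) f + f (double m)
      ≈⟨ +-cong (reflexive (≡.cong (λ k → sumTo k f) (double≡+ m))) f-last ⟩
    sumTo (m ℕ.+ m) f + g * q ^ m
      ≈⟨ +-congʳ (trans (reflexive (≡.cong (λ k → sumTo k f) (ℕ.+-suc m m-1))) (sumTo-+ (suc m) m-1 f)) ⟩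
    sumTo m f + f m + sumTo m-1 (λ i → f (suc m ℕ.+ i)) + g * q ^ m
      ≈⟨ +-congʳ (+-cong (+-cong
           (nested-sum m (double m) (ℕ.m≤n⇒m≤1+n (ℕ.≤-reflexive (≡.sym (double≡+ m)))))
           f-mid)
           (crossed-sum (suc m) m-1 (double m)
             (≡.trans (≡.sym (ℕ.+-suc m m-1)) (≡.sym (double≡+ m)))
             (ℕ.s≤s (ℕ.≤-trans (ℕ.≤-reflexive (double≡+ m)) (ℕ.+-monoʳ-≤ m (ℕ.n≤1+n m)))))) ⟩
    a * ⟦ m ⟧ + q ^ m + g * (q ^ suc m * ⟦ m-1 ⟧) + g * q ^ m
      ≈⟨ solve 6 (λ a g q p x y →
           a :* y :+ p :+ g :* ((q :* p) :* x) :+ g :* p := p :+ (y :* a :+ (con 1 :+ q :* x) :* (g :* p)))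
         refl a g q (q ^ m) ⟦ m-1 ⟧ ⟦ m ⟧ ⟩
    q ^ m + (⟦ m ⟧ * a + (1# + q * ⟦ m-1 ⟧) * (g * q ^ m))
      ≈⟨ +-congˡ (+-congˡ (*-congʳ (⟦⟧-suc m-1))) ⟨
    q ^ m + (⟦ m ⟧ * a + ⟦ m ⟧ * (g * q ^ m))
      ≈⟨ +-congˡ (distribˡ ⟦ m ⟧ _ _) ⟨
    q ^ m + ⟦ m ⟧ * (a + g * q ^ m) ∎
    where
    f = λ c → edge c (double m ∸ c)
    f-mid : f m ≈ q ^ m
    f-mid = trans
      (reflexive (≡.cong (edge m) (≡.trans (≡.cong (_∸ m) (double≡+ m)) (ℕ.m+n∸m≡n m m))))
      (edge-balanced m-1)
    f-last : f (double m) ≈ g * q ^ m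
    f-last rewrite ℕ.n∸n≡0 (double m) = trans (edge-outer (suc (double m-1)))
      (*-congˡ (reflexive (≡.cong (q ^_) (⌊double/2⌋ m))))

  -- The factor α + γ q^m of the down steps from height 2m + 2 sits on the up steps in J.
  gauge : ℕ → Carrier
  gauge zero = 1#
  gauge (suc m) = (a + g * q ^ m) * gauge m

  -- Two steps from height 2m + 1 have coefficient 1 upwards, `lam (2m+1)` + `lam (2m)` on the
  -- diagonal, and `lam (2m)` times `lam (2m-1)` downwards. `J` has the same diagonal, but α + γ q^m
  -- upwards and [m] times `lam (2m)` downwards; `gauge` makes up the difference. It multiplies the
  -- side of `J`, so nothing is divided, and it equals 1 at m = 0, the only index used in the end.
  dyck-J : ∀ n m → dyck (suc (double n)) (suc (double m)) ≈ gauge m * J^ n δ₀ m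
  dyck-J zero zero = begin
    0# + lam 0 * 1#              ≈⟨ +-congˡ (*-congʳ (lam-even 0)) ⟩
    0# + (1# + 0# * (a + g * 1#)) * 1# ≈⟨ solve 2 (λ a g → con 0 :+ (con 1 :+ con 0 :* (a :+ g :* con 1)) :* con 1 := con 1 :* con 1) refl a g ⟩
    1# * 1#                      ∎
  dyck-J zero (suc m) = trans (+-identityˡ _) (trans (zeroʳ _) (sym (zeroʳ _)))
  dyck-J (suc n) zero = begin
    dyck N 3 + lam 1 * dyck N 1 + lam 0 * dyck N 1
      ≈⟨ +-cong (+-cong (dyck-J n 1) (*-cong (lam-odd 0) (dyck-J n 0))) (*-cong (lam-even 0) (dyck-J n 0)) ⟩
    (a + g * 1#) * 1# * f₁ + (0# + 1#) * (a + g * 1#) * (1# * f₀) + (1# + 0# * (a + g * 1#)) * (1# * f₀)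
      ≈⟨ solve 4 (λ a g u v → let one = con 0 :+ con 1; k = a :+ g :* con 1; yu = v :+ one :* u in
           k :* con 1 :* v :+ one :* k :* (con 1 :* u) :+ (con 1 :+ con 0 :* k) :* (con 1 :* u)
           := con 1 :* (con 1 :* u :+ (a :* yu :+ g :* (con 1 :* yu)))) refl a g f₀ f₁ ⟩
    1# * J^ (suc n) δ₀ 0 ∎
    where
    N = suc (double n)
    f₀ = J^ n δ₀ 0
    f₁ = J^ n δ₀ 1
  dyck-J (suc n) (suc m) = begin
    dyck N (suc (double (suc (suc m)))) + lam (suc (double (suc m))) * dyck N (suc (double (suc m)))
      + lam (double (suc m)) * (dyck N (suc (double (suc m))) + lam (suc (double m)) * dyck N (suc (double m)))
      ≈⟨ +-cong
           (+-cong (dyck-J n (suc (suc m))) (*-cong (lam-odd (suc m)) (dyck-J n (suc m))))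
           (*-cong (lam-even (suc m)) (+-cong (dyck-J n (suc m)) (*-cong (lam-odd m) (dyck-J n m)))) ⟩
    (a + g * (q * p)) * ((a + g * p) * c₀) * w + y * (a + g * (q * p)) * ((a + g * p) * c₀ * v)
      + (q * p + x * (a + g * (q * p))) * ((a + g * p) * c₀ * v + x * (a + g * p) * (c₀ * u))
      ≈⟨ solve 10 (λ a g q p c x y u v w →
           let k = a :+ g :* p ; k' = a :+ g :* (q :* p)
               mu = (w :+ y :* v) :+ x :* (v :+ x :* u) in
           k' :* (k :* c) :* w :+ y :* k' :* (k :* c :* v)
             :+ (q :* p :+ x :* k') :* (k :* c :* v :+ x :* k :* (c :* u))
           := k :* c :* (q :* p :* (v :+ x :* u) :+ (a :* mu :+ g :* (q :* p :* mu))))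
         refl a g q p c₀ x y u v w ⟩
    gauge (suc m) * J^ (suc n) δ₀ (suc m) ∎
    where
    N = suc (double n)
    p = q ^ m
    c₀ = gauge m
    x = ⟦ suc m ⟧
    y = ⟦ suc (suc m) ⟧
    u = J^ n δ₀ m
    v = J^ n δ₀ (suc m)
    w = J^ n δ₀ (suc (suc m))

  tab≈dyck : ∀ n → tab n (λ _ → 1#) ≈ dyck (suc (suc (double n))) 0
  tab≈dyck n = begin
    tab n (λ _ → 1#)          ≈⟨ tab-cong n ev-δ₀ ⟨
    tab n (λ j → ev j δ₀)     ≈⟨ tab-ev n δ₀ ⟩
    J^ n δ₀ 0                 ≈⟨ *-identityˡ _ ⟨
    1# * J^ n δ₀ 0            ≈⟨ dyck-J n 0 ⟨
    dyck (suc (double n)) 1   ∎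

  -- One live row is put on top of a column, with an evaluation that may depend on the topmost
  -- label. Above a β the box may be empty or hold α, β, γ, in this order under `O`; above an α or a
  -- γ it must be empty, with weight 1 or q.
  column-step : ∀ k hβ hα hγ →
    O k (λ j → q * hβ (suc j) + (a * hα (suc j) + (hβ j + g * hγ (suc j))))
      + (A k (hα ∘ suc) + G k (λ j → q * hγ (suc j)))
    ≈ O (suc k) hβ + (A (suc k) hα + G (suc k) hγ)
  column-step k hβ hα hγ = begin
    O k (λ j → q * hβ (suc j) + (a * hα (suc j) + (hβ j + g * hγ (suc j)))) + (A k (hα ∘ suc) + G k (λ j → q * hγ (suc j)))
      ≈⟨ +-cong (trans (O-+ k _ _) (+-cong (O-* k q _) (trans (O-+ k _ _) (+-cong (O-* k a _) (trans (O-+ k _ _) (+-congˡ (O-* k g _)))))))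
           (+-congˡ (G-* k q _)) ⟩
    q * O k (hβ ∘ suc) + (a * O k (hα ∘ suc) + (O k hβ + g * O k (hγ ∘ suc))) + (A k (hα ∘ suc) + q * G k (hγ ∘ suc))
      ≈⟨ solve 6 (λ x y z u v w → x :+ (y :+ (z :+ u)) :+ (v :+ w) := z :+ x :+ (v :+ y :+ (w :+ u))) refl _ _ _ _ _ _ ⟩
    O (suc k) hβ + (A (suc k) hα + G (suc k) hγ) ∎

open import Algebra.Structures.Biased using (isCommutativeSemiringˡ)
open import Data.Bool.Properties using (T-irrelevant; T-∧)
open import Data.Empty using (⊥; ⊥-elim)
open import Data.Fin using (Fin; zero; suc; toℕ; fromℕ<; inject≤; punchIn; punchOut; _≟_)
open import Data.Fin.Properties using (toℕ-fromℕ<; toℕ-inject≤; toℕ-injective; toℕ<n; punchInᵢ≢i; punchIn-injective; punchIn-punchOut)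
open import Data.List as List using (List; []; _∷_; allFin; foldr; drop)
open import Data.List.Membership.Propositional using (_∈_)
open import Data.List.Membership.Propositional.Properties using (∈-allFin)
open import Data.List.Properties using (map-tabulate; map-cong)
open import Data.List.Relation.Unary.Any using (here; there)
open import Data.Maybe using (Maybe; just; nothing)
open import Data.Nat using (_+_; _*_; _≤_; _<_; s≤s; z≤n; z<s; s<s; s≤s⁻¹)
open import Data.Nat.ListAction using (sum)
open import Data.Product using (Σ; ∃; _×_; _,_; proj₁; proj₂)
open import Data.Sum using (_⊎_; inj₁; inj₂)
open import Data.Unit using (⊤; tt)
open import Data.Vec using (Vec; []; _∷_; head; tail; map; lookup; toList; zipWith; replicate; tabulate)
open import Data.Vec.Properties using (lookup-zipWith; lookup-replicate; lookup∘tabulate; tabulate∘lookup; tabulate-cong)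
open import Function.Bundles using (Equivalence; _⤖_; Bijection; mk⤖)
open import Relation.Nullary using (¬_; yes; no; contradiction)
open import Relation.Binary.PropositionalEquality using (_≡_; _≢_; refl; sym; trans; cong; cong₂; subst; subst₂)
open import Relation.Binary.Structures using (IsEquivalence)

-- Weighted sets

record Weight : Set where
  constructor ⟨_,_,_⟩
  field
    q-exp α-exp γ-exp : ℕ

infixl 6 _⊕_
_⊕_ : Weight → Weight → Weight
⟨ j , k , l ⟩ ⊕ ⟨ j' , k' , l' ⟩ = ⟨ j + j' , k + k' , l + l' ⟩

cong-⟨⟩ : ∀ {j j' k k' l l'} → j ≡ j' → k ≡ k' → l ≡ l' → ⟨ j , k , l ⟩ ≡ ⟨ j' , k' , l' ⟩
cong-⟨⟩ refl refl refl = refl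

⊕-assoc : ∀ u v w → (u ⊕ v) ⊕ w ≡ u ⊕ (v ⊕ w)
⊕-assoc ⟨ a , b , c ⟩ ⟨ a' , b' , c' ⟩ ⟨ a'' , b'' , c'' ⟩ =
  cong-⟨⟩ (ℕ.+-assoc a a' a'') (ℕ.+-assoc b b' b'') (ℕ.+-assoc c c' c'')

⊕-comm : ∀ u v → u ⊕ v ≡ v ⊕ u
⊕-comm ⟨ a , b , c ⟩ ⟨ a' , b' , c' ⟩ = cong-⟨⟩ (ℕ.+-comm a a') (ℕ.+-comm b b') (ℕ.+-comm c c')

0w : Weight
0w = ⟨ 0 , 0 , 0 ⟩

record WSet : Set₁ where
  constructor _↝_
  field
    Elem : Set
    wt : Elem → Weight
open WSet public

infix 4 _≃_
record _≃_ (X Y : WSet) : Set where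
  field
    to : Elem X → Elem Y
    from : Elem Y → Elem X
    to-from : ∀ y → to (from y) ≡ y
    from-to : ∀ x → from (to x) ≡ x
    wt-to : ∀ x → wt Y (to x) ≡ wt X x
open _≃_ public

≃-refl : ∀ {X} → X ≃ X
≃-refl = record { to = λ x → x ; from = λ x → x ; to-from = λ _ → refl ; from-to = λ _ → refl ; wt-to = λ _ → refl }

≃-sym : ∀ {X Y} → X ≃ Y → Y ≃ X
≃-sym {X} {Y} e = record { to = from e ; from = to e ; to-from = from-to e ; from-to = to-from e
  ; wt-to = λ y → trans (sym (wt-to e (from e y))) (cong (wt Y) (to-from e y)) }

≃-trans : ∀ {X Y Z} → X ≃ Y → Y ≃ Z → X ≃ Z
≃-trans e f = record
  { to = λ x → to f (to e x)
  ; from = λ z → from e (from f z)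
  ; to-from = λ z → trans (cong (to f) (to-from e (from f z))) (to-from f z)
  ; from-to = λ x → trans (cong (from e) (from-to f (to e x))) (from-to e x)
  ; wt-to = λ x → trans (wt-to f (to e x)) (wt-to e x) }

infixl 6 _⊞_
infixl 7 _⊠_
_⊞_ _⊠_ : WSet → WSet → WSet
X ⊞ Y = (Elem X ⊎ Elem Y) ↝ λ { (inj₁ x) → wt X x ; (inj₂ y) → wt Y y }
X ⊠ Y = (Elem X × Elem Y) ↝ λ (x , y) → wt X x ⊕ wt Y y

single : Weight → WSet
single w = ⊤ ↝ λ _ → w

𝟘 𝟙 : WSet
𝟘 = ⊥ ↝ λ ()
𝟙 = single 0w

⊞-cong : ∀ {X X' Y Y'} → X ≃ X' → Y ≃ Y' → X ⊞ Y ≃ X' ⊞ Y'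
⊞-cong e f = record
  { to = λ { (inj₁ x) → inj₁ (to e x) ; (inj₂ y) → inj₂ (to f y) }
  ; from = λ { (inj₁ x) → inj₁ (from e x) ; (inj₂ y) → inj₂ (from f y) }
  ; to-from = λ { (inj₁ x) → cong inj₁ (to-from e x) ; (inj₂ y) → cong inj₂ (to-from f y) }
  ; from-to = λ { (inj₁ x) → cong inj₁ (from-to e x) ; (inj₂ y) → cong inj₂ (from-to f y) }
  ; wt-to = λ { (inj₁ x) → wt-to e x ; (inj₂ y) → wt-to f y } }

⊞-assoc : ∀ X Y Z → (X ⊞ Y) ⊞ Z ≃ X ⊞ (Y ⊞ Z)
⊞-assoc X Y Z = record
  { to = λ { (inj₁ (inj₁ x)) → inj₁ x ; (inj₁ (inj₂ y)) → inj₂ (inj₁ y) ; (inj₂ z) → inj₂ (inj₂ z) }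
  ; from = λ { (inj₁ x) → inj₁ (inj₁ x) ; (inj₂ (inj₁ y)) → inj₁ (inj₂ y) ; (inj₂ (inj₂ z)) → inj₂ z }
  ; to-from = λ { (inj₁ x) → refl ; (inj₂ (inj₁ y)) → refl ; (inj₂ (inj₂ z)) → refl }
  ; from-to = λ { (inj₁ (inj₁ x)) → refl ; (inj₁ (inj₂ y)) → refl ; (inj₂ z) → refl }
  ; wt-to = λ { (inj₁ (inj₁ x)) → refl ; (inj₁ (inj₂ y)) → refl ; (inj₂ z) → refl } }

⊞-comm : ∀ X Y → X ⊞ Y ≃ Y ⊞ X
⊞-comm X Y = record
  { to = λ { (inj₁ x) → inj₂ x ; (inj₂ y) → inj₁ y }
  ; from = λ { (inj₁ x) → inj₂ x ; (inj₂ y) → inj₁ y }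
  ; to-from = λ { (inj₁ x) → refl ; (inj₂ y) → refl }
  ; from-to = λ { (inj₁ x) → refl ; (inj₂ y) → refl }
  ; wt-to = λ { (inj₁ x) → refl ; (inj₂ y) → refl } }

⊞-identityˡ : ∀ X → 𝟘 ⊞ X ≃ X
⊞-identityˡ X = record
  { to = λ { (inj₂ x) → x }
  ; from = inj₂
  ; to-from = λ _ → refl
  ; from-to = λ { (inj₂ x) → refl }
  ; wt-to = λ { (inj₂ x) → refl } }

⊠-cong : ∀ {X X' Y Y'} → X ≃ X' → Y ≃ Y' → X ⊠ Y ≃ X' ⊠ Y'
⊠-cong e f = record
  { to = λ (x , y) → to e x , to f y
  ; from = λ (x , y) → from e x , from f y
  ; to-from = λ (x , y) → cong₂ _,_ (to-from e x) (to-from f y)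
  ; from-to = λ (x , y) → cong₂ _,_ (from-to e x) (from-to f y)
  ; wt-to = λ (x , y) → cong₂ _⊕_ (wt-to e x) (wt-to f y) }

⊠-assoc : ∀ X Y Z → (X ⊠ Y) ⊠ Z ≃ X ⊠ (Y ⊠ Z)
⊠-assoc X Y Z = record
  { to = λ ((x , y) , z) → x , y , z
  ; from = λ (x , y , z) → (x , y) , z
  ; to-from = λ _ → refl
  ; from-to = λ _ → refl
  ; wt-to = λ ((x , y) , z) → sym (⊕-assoc (wt X x) (wt Y y) (wt Z z)) }

⊠-comm : ∀ X Y → X ⊠ Y ≃ Y ⊠ X
⊠-comm X Y = record
  { to = λ (x , y) → y , x
  ; from = λ (y , x) → x , y
  ; to-from = λ _ → refl
  ; from-to = λ _ → refl
  ; wt-to = λ (x , y) → ⊕-comm (wt Y y) (wt X x) }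

⊠-identityˡ : ∀ X → 𝟙 ⊠ X ≃ X
⊠-identityˡ X = record
  { to = proj₂
  ; from = tt ,_
  ; to-from = λ _ → refl
  ; from-to = λ _ → refl
  ; wt-to = λ _ → refl }

⊠-zeroˡ : ∀ X → 𝟘 ⊠ X ≃ 𝟘
⊠-zeroˡ X = record { to = λ () ; from = λ () ; to-from = λ () ; from-to = λ () ; wt-to = λ () }

⊠-distribʳ-⊞ : ∀ Z X Y → (X ⊞ Y) ⊠ Z ≃ (X ⊠ Z) ⊞ (Y ⊠ Z)
⊠-distribʳ-⊞ Z X Y = record
  { to = λ { (inj₁ x , z) → inj₁ (x , z) ; (inj₂ y , z) → inj₂ (y , z) }
  ; from = λ { (inj₁ (x , z)) → inj₁ x , z ; (inj₂ (y , z)) → inj₂ y , z }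
  ; to-from = λ { (inj₁ _) → refl ; (inj₂ _) → refl }
  ; from-to = λ { (inj₁ _ , _) → refl ; (inj₂ _ , _) → refl }
  ; wt-to = λ { (inj₁ _ , _) → refl ; (inj₂ _ , _) → refl } }

WSet-commutativeSemiring : CommutativeSemiring _ _
WSet-commutativeSemiring = record
  { Carrier = WSet ; _≈_ = _≃_ ; _+_ = _⊞_ ; _*_ = _⊠_ ; 0# = 𝟘 ; 1# = 𝟙
  ; isCommutativeSemiring = isCommutativeSemiringˡ (record
    { +-isCommutativeMonoid = record
      { isMonoid = record
        { isSemigroup = record
          { isMagma = record { isEquivalence = equiv ; ∙-cong = ⊞-cong } ; assoc = ⊞-assoc }
        ; identity = ⊞-identityˡ , λ X → ≃-trans (⊞-comm X 𝟘) (⊞-identityˡ X) }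
      ; comm = ⊞-comm }
    ; *-isCommutativeMonoid = record
      { isMonoid = record
        { isSemigroup = record
          { isMagma = record { isEquivalence = equiv ; ∙-cong = ⊠-cong } ; assoc = ⊠-assoc }
        ; identity = ⊠-identityˡ , λ X → ≃-trans (⊠-comm X 𝟙) (⊠-identityˡ X) }
      ; comm = ⊠-comm }
    ; distribʳ = ⊠-distribʳ-⊞
    ; zeroˡ = ⊠-zeroˡ }) }
  where
  equiv : IsEquivalence _≃_
  equiv = record { refl = ≃-refl ; sym = ≃-sym ; trans = ≃-trans }

single-⊕ : ∀ u v → single (u ⊕ v) ≃ single u ⊠ single v
single-⊕ u v = record { to = λ _ → tt , tt ; from = λ _ → tt ; to-from = λ _ → refl ; from-to = λ _ → refl ; wt-to = λ _ → refl }

≃-reflexive : ∀ {X Y} → X ≡ Y → X ≃ Y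
≃-reflexive refl = ≃-refl

⨁ : (A : Set) → (A → WSet) → WSet
⨁ A F = Σ A (λ x → Elem (F x)) ↝ λ (x , y) → wt (F x) y

⨁-cong : ∀ {A F F'} → (∀ x → F x ≃ F' x) → ⨁ A F ≃ ⨁ A F'
⨁-cong e = record
  { to = λ (x , y) → x , to (e x) y
  ; from = λ (x , y) → x , from (e x) y
  ; to-from = λ (x , y) → cong (x ,_) (to-from (e x) y)
  ; from-to = λ (x , y) → cong (x ,_) (from-to (e x) y)
  ; wt-to = λ (x , y) → wt-to (e x) y }

⨁-⊠ : ∀ {A} X (F : A → WSet) → ⨁ A (λ x → X ⊠ F x) ≃ X ⊠ ⨁ A F
⨁-⊠ X F = record
  { to = λ (x , y , z) → y , x , z
  ; from = λ (y , x , z) → x , y , z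
  ; to-from = λ _ → refl
  ; from-to = λ _ → refl
  ; wt-to = λ _ → refl }

⨁-× : ∀ {A B} (F : A × B → WSet) → ⨁ (A × B) F ≃ ⨁ A (λ x → ⨁ B (λ y → F (x , y)))
⨁-× F = record
  { to = λ ((x , y) , z) → x , y , z
  ; from = λ (x , y , z) → (x , y) , z
  ; to-from = λ _ → refl
  ; from-to = λ _ → refl
  ; wt-to = λ _ → refl }

⨁-reindex : ∀ {A B : Set} (f : A → B) (f⁻¹ : B → A) → (∀ x → f⁻¹ (f x) ≡ x) → (∀ y → f (f⁻¹ y) ≡ y) →
  ∀ F → ⨁ A (λ x → F (f x)) ≃ ⨁ B F
⨁-reindex {A} {B} f f⁻¹ f⁻¹-f f-f⁻¹ F = record
  { to = λ (x , z) → f x , z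
  ; from = λ (y , z) → f⁻¹ y , coe (sym (f-f⁻¹ y)) z
  ; to-from = λ (y , z) → coe-pair (sym (f-f⁻¹ y)) z
  ; from-to = λ (x , z) → back x z (f⁻¹-f x) (sym (f-f⁻¹ (f x)))
  ; wt-to = λ _ → refl }
  where
  coe : ∀ {y y'} → y ≡ y' → Elem (F y) → Elem (F y')
  coe refl z = z
  coe-pair : ∀ {y y'} (eq : y ≡ y') (z : Elem (F y)) → (y' , coe eq z) ≡ (y , z)
  coe-pair refl z = refl
  back : ∀ x z {x'} → x' ≡ x → (eq : f x ≡ f x') → (x' , coe eq z) ≡ (x , z)
  back x z refl refl = refl

empty : ∀ {X Y} → (Elem X → ⊥) → (Elem Y → ⊥) → X ≃ Y
empty ¬x ¬y = record
  { to = λ x → ⊥-elim (¬x x)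
  ; from = λ y → ⊥-elim (¬y y)
  ; to-from = λ y → ⊥-elim (¬y y)
  ; from-to = λ x → ⊥-elim (¬x x)
  ; wt-to = λ x → ⊥-elim (¬x x) }

-- Sets cut out by Boolean tests

guard : Bool → WSet
guard b = T b ↝ λ _ → 0w

guard-∧ : ∀ b b' → guard (b ∧ b') ≃ guard b ⊠ guard b'
guard-∧ true b' = ≃-sym (⊠-identityˡ (guard b'))
guard-∧ false b' = empty (λ ()) (λ ())

filter : (A : Set) → (A → Bool) → (A → Weight) → WSet
filter A P w = Σ A (λ x → T (P x)) ↝ λ (x , _) → w x

filter-⨁ : ∀ {A} P w → filter A P w ≃ ⨁ A (λ x → guard (P x) ⊠ single (w x))
filter-⨁ P w = record
  { to = λ (x , p) → x , p , tt
  ; from = λ (x , p , _) → x , p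
  ; to-from = λ _ → refl
  ; from-to = λ _ → refl
  ; wt-to = λ _ → refl }

filter-≡ : ∀ {A : Set} {P : A → Bool} {x y : Σ A (λ x → T (P x))} → proj₁ x ≡ proj₁ y → x ≡ y
filter-≡ {x = x , _} refl = cong (x ,_) (T-irrelevant _ _)

filter-cong : ∀ {A : Set} {P P' : A → Bool} {w w' : A → Weight} → (∀ x → T (P x) → T (P' x)) → (∀ x → T (P' x) → T (P x)) →
  (∀ x → T (P' x) → w' x ≡ w x) → filter A P w ≃ filter A P' w'
filter-cong P⇒P' P'⇒P w'≡w = record
  { to = λ (x , p) → x , P⇒P' x p
  ; from = λ (x , p) → x , P'⇒P x p
  ; to-from = λ _ → filter-≡ refl
  ; from-to = λ _ → filter-≡ refl
  ; wt-to = λ (x , p) → w'≡w x (P⇒P' x p) }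

⨁-⊞ : ∀ {A} (F F' : A → WSet) → ⨁ A (λ x → F x ⊞ F' x) ≃ ⨁ A F ⊞ ⨁ A F'
⨁-⊞ F F' = record
  { to = λ { (x , inj₁ y) → inj₁ (x , y) ; (x , inj₂ y) → inj₂ (x , y) }
  ; from = λ { (inj₁ (x , y)) → x , inj₁ y ; (inj₂ (x , y)) → x , inj₂ y }
  ; to-from = λ { (inj₁ _) → refl ; (inj₂ _) → refl }
  ; from-to = λ { (_ , inj₁ _) → refl ; (_ , inj₂ _) → refl }
  ; wt-to = λ { (_ , inj₁ _) → refl ; (_ , inj₂ _) → refl } }

guard-split : ∀ b t → guard b ≃ guard (b ∧ not t) ⊞ guard (b ∧ t)
guard-split false t = empty (λ ()) (λ { (inj₁ ()) ; (inj₂ ()) })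
guard-split true false = record
  { to = inj₁ ; from = λ { (inj₁ x) → x } ; to-from = λ { (inj₁ x) → refl } ; from-to = λ _ → refl ; wt-to = λ _ → refl }
guard-split true true = record
  { to = inj₂ ; from = λ { (inj₂ x) → x } ; to-from = λ { (inj₂ x) → refl } ; from-to = λ _ → refl ; wt-to = λ _ → refl }

filter-split : ∀ {A} (P t : A → Bool) w →
  filter A P w ≃ filter A (λ x → P x ∧ not (t x)) w ⊞ filter A (λ x → P x ∧ t x) w
filter-split P t w = ≃-trans (filter-⨁ P w)
  (≃-trans (⨁-cong λ x → ≃-trans
      (⊠-cong (guard-split (P x) (t x)) ≃-refl)
      (⊠-distribʳ-⊞ (single (w x)) (guard (P x ∧ not (t x))) (guard (P x ∧ t x))))
  (≃-trans (⨁-⊞ _ _) (⊞-cong (≃-sym (filter-⨁ _ w)) (≃-sym (filter-⨁ _ w)))))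

-- Columns and tableaux

𝐪 𝐚 𝐠 : WSet
𝐪 = single ⟨ 1 , 0 , 0 ⟩
𝐚 = single ⟨ 0 , 1 , 0 ⟩
𝐠 = single ⟨ 0 , 0 , 1 ⟩

open Intertwining WSet-commutativeSemiring 𝐪 𝐚 𝐠
open CommutativeSemiring WSet-commutativeSemiring using (setoid; +-identityʳ; +-congˡ; *-congʳ)
open import Relation.Binary.Reasoning.Setoid setoid

label : ∀ {N} → Vec Cell N → Maybe Cell
label cs = firstLabel (toList cs)

label∷ : Cell → Maybe Cell → Maybe Cell
label∷ ○ b = b
label∷ c _ = just c

label-∷ : ∀ {N} c (cs : Vec Cell N) → label (c ∷ cs) ≡ label∷ c (label cs)
label-∷ ○ cs = refl
label-∷ α cs = refl
label-∷ β cs = refl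
label-∷ γ cs = refl
label-∷ δ cs = refl

live∷ : Cell → Bool → Bool
live∷ ○ l = l
live∷ c _ = isαγ c

isJustβ isJustβγ : Maybe Cell → Bool
isJustβ (just β) = true
isJustβ _ = false
isJustβγ (just β) = true
isJustβγ (just γ) = true
isJustβγ _ = false

-- The Maybe Cell argument is the nearest label below the box.
okCell : Bool → Maybe Cell → Cell → Bool
okCell l b ○ = true
okCell l b δ = false
okCell l b _ = l ∧ isJustβ b

cellWt : Bool → Maybe Cell → Cell → Weight
cellWt l b ○ = if l ∧ isJustβγ b then ⟨ 1 , 0 , 0 ⟩ else 0w
cellWt l b α = ⟨ 0 , 1 , 0 ⟩
cellWt l b γ = ⟨ 0 , 0 , 1 ⟩
cellWt l b _ = 0w

okDiag : Cell → Bool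
okDiag c = not (isEmpty c) ∧ not (isδ c)

allEmpty : ∀ {N} → Vec Cell N → Bool
allEmpty [] = true
allEmpty (c ∷ cs) = isEmpty c ∧ allEmpty cs

-- n is the index of the diagonal row of the column, and ls records which rows above it are live.
colOK : ∀ {N} → ℕ → Vec Bool N → Vec Cell N → Bool
colOK n [] [] = true
colOK zero (l ∷ ls) (c ∷ cs) = okDiag c ∧ allEmpty cs
colOK (suc n) (l ∷ ls) (c ∷ cs) = okCell l (label cs) c ∧ colOK n ls cs

colWt : ∀ {N} → ℕ → Vec Bool N → Vec Cell N → Weight
colWt n [] [] = 0w
colWt zero (l ∷ ls) (c ∷ cs) = cellWt false nothing c
colWt (suc n) (l ∷ ls) (c ∷ cs) = cellWt l (label cs) c ⊕ colWt n ls cs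

bump : Bool → ℕ → ℕ
bump l k = if l then suc k else k

-- Only the rows with index less than n meet the columns already read.
liveCount : ∀ {N} → ℕ → Vec Bool N → ℕ
liveCount zero ls = zero
liveCount (suc n) [] = zero
liveCount (suc n) (l ∷ ls) = bump l (liveCount n ls)

⨁-Cell : ∀ F → ⨁ Cell F ≃ F ○ ⊞ (F α ⊞ (F β ⊞ (F γ ⊞ F δ)))
⨁-Cell F = record
  { to = λ { (○ , x) → inj₁ x ; (α , x) → inj₂ (inj₁ x) ; (β , x) → inj₂ (inj₂ (inj₁ x))
           ; (γ , x) → inj₂ (inj₂ (inj₂ (inj₁ x))) ; (δ , x) → inj₂ (inj₂ (inj₂ (inj₂ x))) }
  ; from = λ { (inj₁ x) → ○ , x ; (inj₂ (inj₁ x)) → α , x ; (inj₂ (inj₂ (inj₁ x))) → β , x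
             ; (inj₂ (inj₂ (inj₂ (inj₁ x)))) → γ , x ; (inj₂ (inj₂ (inj₂ (inj₂ x)))) → δ , x }
  ; to-from = λ { (inj₁ x) → refl ; (inj₂ (inj₁ x)) → refl ; (inj₂ (inj₂ (inj₁ x))) → refl
                ; (inj₂ (inj₂ (inj₂ (inj₁ x)))) → refl ; (inj₂ (inj₂ (inj₂ (inj₂ x)))) → refl }
  ; from-to = λ { (○ , x) → refl ; (α , x) → refl ; (β , x) → refl ; (γ , x) → refl ; (δ , x) → refl }
  ; wt-to = λ { (○ , x) → refl ; (α , x) → refl ; (β , x) → refl ; (γ , x) → refl ; (δ , x) → refl } }

guard-true : ∀ {X} → guard true ⊠ X ≃ X
guard-true {X} = ⊠-identityˡ X

guard-false : ∀ {X} → guard false ⊠ X ≃ 𝟘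
guard-false = empty (λ ()) (λ ())

guard-one : ∀ {X} → guard true ⊠ (𝟙 ⊠ X) ≃ X
guard-one {X} = ≃-trans guard-true (⊠-identityˡ X)

⨁-Cell-○ : ∀ {F X} → F ○ ≃ X → F α ≃ 𝟘 → F β ≃ 𝟘 → F γ ≃ 𝟘 → F δ ≃ 𝟘 → ⨁ Cell F ≃ X
⨁-Cell-○ {F} {X} e○ eα eβ eγ eδ = begin
  ⨁ Cell F                                ≈⟨ ⨁-Cell F ⟩
  F ○ ⊞ (F α ⊞ (F β ⊞ (F γ ⊞ F δ)))       ≈⟨ ⊞-cong e○ (⊞-cong eα (⊞-cong eβ (⊞-cong eγ eδ))) ⟩
  X ⊞ (𝟘 ⊞ (𝟘 ⊞ (𝟘 ⊞ 𝟘)))                 ≈⟨ +-congˡ (≃-trans (⊞-identityˡ _) (≃-trans (⊞-identityˡ _) (⊞-identityˡ 𝟘))) ⟩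
  X ⊞ 𝟘                                   ≈⟨ +-identityʳ X ⟩
  X                                       ∎

⨁-Vec : ∀ {A N} (F : Vec A (suc N) → WSet) → ⨁ (Vec A (suc N)) F ≃ ⨁ (Vec A N) (λ xs → ⨁ A (λ x → F (x ∷ xs)))
⨁-Vec F = record
  { to = λ { (x ∷ xs , z) → xs , x , z }
  ; from = λ (xs , x , z) → x ∷ xs , z
  ; to-from = λ _ → refl
  ; from-to = λ { (x ∷ xs , z) → refl }
  ; wt-to = λ { (x ∷ xs , z) → refl } }

guard-single : ∀ b b' w w' X →
  guard (b ∧ b') ⊠ (single (w ⊕ w') ⊠ X) ≃ guard b' ⊠ (single w' ⊠ (guard b ⊠ (single w ⊠ X)))
guard-single b b' w w' X = begin
  guard (b ∧ b') ⊠ (single (w ⊕ w') ⊠ X)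
    ≈⟨ ⊠-cong (guard-∧ b b') (*-congʳ (single-⊕ w w')) ⟩
  (guard b ⊠ guard b') ⊠ ((single w ⊠ single w') ⊠ X)
    ≈⟨ shuffle (guard b) (guard b') (single w) (single w') X ⟩
  guard b' ⊠ (single w' ⊠ (guard b ⊠ (single w ⊠ X))) ∎
  where
  shuffle : ∀ P P' V V' X → (P ⊠ P') ⊠ ((V ⊠ V') ⊠ X) ≃ P' ⊠ (V' ⊠ (P ⊠ (V ⊠ X)))
  shuffle = solve 5 (λ P P' V V' X → (P :* P') :* ((V :* V') :* X) := P' :* (V' :* (P :* (V :* X)))) ≃-refl
    where open import Algebra.Solver.Ring.NaturalCoefficients.Default WSet-commutativeSemiring using (solve; _:*_; _:=_)

⨁-guard : ∀ {A} (b : A → Bool) b' (w : A → Weight) w' (X : A → WSet) →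
  ⨁ A (λ x → guard (b x ∧ b') ⊠ (single (w x ⊕ w') ⊠ X x)) ≃
  guard b' ⊠ (single w' ⊠ ⨁ A (λ x → guard (b x) ⊠ (single (w x) ⊠ X x)))
⨁-guard {A} b b' w w' X = begin
  ⨁ A (λ x → guard (b x ∧ b') ⊠ (single (w x ⊕ w') ⊠ X x))
    ≈⟨ ⨁-cong (λ x → guard-single (b x) b' (w x) w' (X x)) ⟩
  ⨁ A (λ x → guard b' ⊠ (single w' ⊠ F x))
    ≈⟨ ⨁-⊠ (guard b') (λ x → single w' ⊠ F x) ⟩
  guard b' ⊠ ⨁ A (λ x → single w' ⊠ F x)
    ≈⟨ ⊠-cong (≃-refl {guard b'}) (⨁-⊠ (single w') F) ⟩
  guard b' ⊠ (single w' ⊠ ⨁ A F) ∎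
  where
  F : A → WSet
  F x = guard (b x) ⊠ (single (w x) ⊠ X x)

⨁-allEmpty : ∀ N X → ⨁ (Vec Cell N) (λ cs → guard (allEmpty cs) ⊠ X) ≃ X
⨁-allEmpty zero X = record
  { to = λ (_ , _ , x) → x ; from = λ x → [] , tt , x ; to-from = λ _ → refl
  ; from-to = λ { ([] , _ , _) → refl } ; wt-to = λ { ([] , _ , _) → refl } }
⨁-allEmpty (suc N) X = begin
  ⨁ (Vec Cell (suc N)) (λ cs → guard (allEmpty cs) ⊠ X)
    ≈⟨ ⨁-Vec _ ⟩
  ⨁ (Vec Cell N) (λ cs → ⨁ Cell (λ c → guard (isEmpty c ∧ allEmpty cs) ⊠ X))
    ≈⟨ ⨁-cong (λ cs → ⨁-Cell-○ ≃-refl guard-false guard-false guard-false guard-false) ⟩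
  ⨁ (Vec Cell N) (λ cs → guard (allEmpty cs) ⊠ X)
    ≈⟨ ⨁-allEmpty N X ⟩
  X ∎

module _ (l : Bool) (H : Maybe Cell → ℕ → WSet) where
  -- The sum over the box placed on a column with topmost label `b` and `j` live rows so far. It is
  -- again a function of a label and a number, so it can take the place of `H`.
  addCell : Maybe Cell → ℕ → WSet
  addCell b j = ⨁ Cell (λ c → guard (okCell l b c) ⊠ (single (cellWt l b c) ⊠ H (label∷ c b) (bump (live∷ c l) j)))

module _ (H : Maybe Cell → ℕ → WSet) where
  addCell-dead : ∀ b j → addCell false H b j ≃ H b j
  addCell-dead b j = ⨁-Cell-○ guard-one guard-false guard-false guard-false guard-false

  addCell-α : ∀ j → addCell true H (just α) j ≃ H (just α) (suc j)
  addCell-α j = ⨁-Cell-○ guard-one guard-false guard-false guard-false guard-false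

  addCell-γ : ∀ j → addCell true H (just γ) j ≃ 𝐪 ⊠ H (just γ) (suc j)
  addCell-γ j = ⨁-Cell-○ guard-true guard-false guard-false guard-false guard-false

  addCell-β : ∀ j → addCell true H (just β) j ≃
    𝐪 ⊠ H (just β) (suc j) ⊞ (𝐚 ⊠ H (just α) (suc j) ⊞ (H (just β) j ⊞ 𝐠 ⊠ H (just γ) (suc j)))
  addCell-β j = ≃-trans (⨁-Cell _)
    (⊞-cong guard-true (⊞-cong guard-true (⊞-cong guard-one (≃-trans (⊞-cong guard-true guard-false) (+-identityʳ _)))))

-- `H` depends on the topmost label as well as on the number of live rows, because the next box
-- above needs both. This makes the induction close: the top box is absorbed into `addCell l H`, and
-- the hypothesis is applied to the shorter column with that function.
⨁-column : ∀ {N} n → n < N → (ls : Vec Bool N) (H : Maybe Cell → ℕ → WSet) →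
  ⨁ (Vec Cell N) (λ cs → guard (colOK n ls cs) ⊠
    (single (colWt n ls cs) ⊠ H (label cs) (liveCount (suc n) (zipWith live∷ cs ls))))
  ≃ O (liveCount n ls) (H (just β)) ⊞ (A (liveCount n ls) (H (just α)) ⊞ G (liveCount n ls) (H (just γ)))
⨁-column {suc N} zero _ (l ∷ ls) H = begin
  ⨁ (Vec Cell (suc N)) _
    ≈⟨ ⨁-Vec _ ⟩
  ⨁ (Vec Cell N) (λ cs → ⨁ Cell (λ c → guard (okDiag c ∧ allEmpty cs) ⊠ (single (cellWt false nothing c)
    ⊠ H (label (c ∷ cs)) (bump (live∷ c l) 0))))
    ≈⟨ ⨁-cong (λ cs → ≃-trans (⨁-Cell _) (≃-trans (⊞-cong guard-false (⊞-cong ≃-refl (⊞-cong ≃-refl (⊞-cong ≃-refl guard-false))))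
         (regroup (guard (allEmpty cs)) 𝐚 𝐠 (H (just α) 1) (H (just β) 0) (H (just γ) 1)))) ⟩
  ⨁ (Vec Cell N) (λ cs → guard (allEmpty cs) ⊠ (H (just β) 0 ⊞ (𝐚 ⊠ H (just α) 1 ⊞ 𝐠 ⊠ H (just γ) 1)))
    ≈⟨ ⨁-allEmpty N _ ⟩
  H (just β) 0 ⊞ (𝐚 ⊠ H (just α) 1 ⊞ 𝐠 ⊠ H (just γ) 1) ∎
  where
  regroup : ∀ P 𝐚 𝐠 x y z →
    𝟘 ⊞ (P ⊠ (𝐚 ⊠ x) ⊞ (P ⊠ (𝟙 ⊠ y) ⊞ (P ⊠ (𝐠 ⊠ z) ⊞ 𝟘))) ≃ P ⊠ (y ⊞ (𝐚 ⊠ x ⊞ 𝐠 ⊠ z))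
  regroup = solve 6 (λ P 𝐚 𝐠 x y z →
    con 0 :+ (P :* (𝐚 :* x) :+ (P :* (con 1 :* y) :+ (P :* (𝐠 :* z) :+ con 0))) := P :* (y :+ (𝐚 :* x :+ 𝐠 :* z))) ≃-refl
    where open import Algebra.Solver.Ring.NaturalCoefficients.Default WSet-commutativeSemiring using (solve; _:+_; _:*_; _:=_; con)
⨁-column {suc N} (suc n) (s≤s n<N) (l ∷ ls) H = begin
  ⨁ (Vec Cell (suc N)) _
    ≈⟨ ⨁-Vec _ ⟩
  ⨁ (Vec Cell N) (λ cs → ⨁ Cell (λ c → guard (okCell l (label cs) c ∧ colOK n ls cs) ⊠
      (single (cellWt l (label cs) c ⊕ colWt n ls cs) ⊠ H (label (c ∷ cs)) (bump (live∷ c l) (k' cs)))))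
    ≈⟨ ⨁-cong peel ⟩
  ⨁ (Vec Cell N) (λ cs → guard (colOK n ls cs) ⊠ (single (colWt n ls cs) ⊠ addCell l H (label cs) (k' cs)))
    ≈⟨ ⨁-column n n<N ls (addCell l H) ⟩
  O k (addCell l H (just β)) ⊞ (A k (addCell l H (just α)) ⊞ G k (addCell l H (just γ)))
    ≈⟨ step l ⟩
  O (bump l k) (H (just β)) ⊞ (A (bump l k) (H (just α)) ⊞ G (bump l k) (H (just γ))) ∎
  where
  k = liveCount n ls
  k' : Vec Cell N → ℕ
  k' cs = liveCount (suc n) (zipWith live∷ cs ls)
  peel : ∀ cs → ⨁ Cell (λ c → guard (okCell l (label cs) c ∧ colOK n ls cs) ⊠
      (single (cellWt l (label cs) c ⊕ colWt n ls cs) ⊠ H (label (c ∷ cs)) (bump (live∷ c l) (k' cs))))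
    ≃ guard (colOK n ls cs) ⊠ (single (colWt n ls cs) ⊠ addCell l H (label cs) (k' cs))
  peel cs = ≃-trans
    (⨁-cong (λ c → ≃-reflexive (cong (λ x → guard (okCell l (label cs) c ∧ colOK n ls cs) ⊠
      (single (cellWt l (label cs) c ⊕ colWt n ls cs) ⊠ H x (bump (live∷ c l) (k' cs)))) (label-∷ c cs))))
    (⨁-guard (okCell l (label cs)) (colOK n ls cs) (cellWt l (label cs)) (colWt n ls cs)
      (λ c → H (label∷ c (label cs)) (bump (live∷ c l) (k' cs))))
  step : ∀ l → O k (addCell l H (just β)) ⊞ (A k (addCell l H (just α)) ⊞ G k (addCell l H (just γ)))
    ≃ O (bump l k) (H (just β)) ⊞ (A (bump l k) (H (just α)) ⊞ G (bump l k) (H (just γ)))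
  step false = ⊞-cong (O-cong k (addCell-dead H (just β))) (⊞-cong (A-cong k (addCell-dead H (just α))) (G-cong k (addCell-dead H (just γ))))
  step true = ≃-trans
    (⊞-cong (O-cong k (addCell-β H)) (⊞-cong (A-cong k (addCell-α H)) (G-cong k (addCell-γ H))))
    (column-step k (H (just β)) (H (just α)) (H (just γ)))

-- Removing the first column of a staircase of size n + 1 leaves one of size n but all N rows of the
-- array; hence the separate dimensions n and N here and below. The first column is the one read
-- last.
liveVec : ∀ {n N} → Vec (Vec Cell n) N → Vec Bool N
liveVec {zero} t = replicate _ false
liveVec {suc n} t = zipWith live∷ (map head t) (liveVec (map tail t))

valid : ∀ {n N} → Vec (Vec Cell n) N → Bool
valid {zero} t = true
valid {suc n} t = colOK n (liveVec (map tail t)) (map head t) ∧ valid (map tail t)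

tabWt : ∀ {n N} → Vec (Vec Cell n) N → Weight
tabWt {zero} t = 0w
tabWt {suc n} t = colWt n (liveVec (map tail t)) (map head t) ⊕ tabWt (map tail t)

heads-tails : ∀ {n N} → Vec (Vec Cell (suc n)) N → Vec (Vec Cell n) N × Vec Cell N
heads-tails t = map tail t , map head t

cons-column : ∀ {n N} → Vec (Vec Cell n) N × Vec Cell N → Vec (Vec Cell (suc n)) N
cons-column (t , c) = zipWith _∷_ c t

cons-heads-tails : ∀ {n N} (t : Vec (Vec Cell (suc n)) N) → cons-column (heads-tails t) ≡ t
cons-heads-tails [] = refl
cons-heads-tails ((c ∷ cs) ∷ t) = cong ((c ∷ cs) ∷_) (cons-heads-tails t)

heads-tails-cons : ∀ {n N} (tc : Vec (Vec Cell n) N × Vec Cell N) → heads-tails (cons-column tc) ≡ tc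
heads-tails-cons ([] , []) = refl
heads-tails-cons (r ∷ t , c ∷ cs) = cong (λ (t , cs) → r ∷ t , c ∷ cs) (heads-tails-cons (t , cs))

⨁-tableau : ∀ {n N} → n ≤ N → ∀ h →
  ⨁ (Vec (Vec Cell n) N) (λ t → guard (valid t) ⊠ (single (tabWt t) ⊠ h (liveCount n (liveVec t)))) ≃ tab n h
⨁-tableau {zero} {N} _ h = ≃-trans (⨁-cong (λ t → guard-one)) unique
  where
  all-[] : ∀ {N} (t : Vec (Vec Cell 0) N) → replicate N [] ≡ t
  all-[] [] = refl
  all-[] ([] ∷ t) = cong ([] ∷_) (all-[] t)
  unique : ⨁ (Vec (Vec Cell 0) N) (λ _ → h 0) ≃ h 0
  unique = record { to = proj₂ ; from = λ x → replicate N [] , x ; to-from = λ _ → refl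
    ; from-to = λ (t , x) → cong (_, x) (all-[] t) ; wt-to = λ _ → refl }
⨁-tableau {suc n} {N} n<N h = begin
  ⨁ (Vec (Vec Cell (suc n)) N) (λ t → F (heads-tails t))
    ≈⟨ ⨁-reindex heads-tails cons-column cons-heads-tails heads-tails-cons F ⟩
  ⨁ (Vec (Vec Cell n) N × Vec Cell N) F
    ≈⟨ ⨁-× F ⟩
  ⨁ (Vec (Vec Cell n) N) (λ t → ⨁ (Vec Cell N) (λ c → F (t , c)))
    ≈⟨ ⨁-cong peel ⟩
  ⨁ (Vec (Vec Cell n) N) (λ t → guard (valid t) ⊠ (single (tabWt t) ⊠ column (liveCount n (liveVec t)) h))
    ≈⟨ ⨁-tableau (ℕ.<⇒≤ n<N) (λ k → column k h) ⟩
  tab (suc n) h ∎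
  where
  F : Vec (Vec Cell n) N × Vec Cell N → WSet
  F (t , c) = guard (colOK n (liveVec t) c ∧ valid t) ⊠
    (single (colWt n (liveVec t) c ⊕ tabWt t) ⊠ h (liveCount (suc n) (zipWith live∷ c (liveVec t))))
  peel : ∀ t → ⨁ (Vec Cell N) (λ c → F (t , c)) ≃ guard (valid t) ⊠ (single (tabWt t) ⊠ column (liveCount n (liveVec t)) h)
  peel t = ≃-trans
    (⨁-guard (colOK n (liveVec t)) (valid t) (colWt n (liveVec t)) (tabWt t)
      (λ c → h (liveCount (suc n) (zipWith live∷ c (liveVec t)))))
    (⊠-cong (≃-refl {guard (valid t)}) (⊠-cong (≃-refl {single (tabWt t)}) (⨁-column n n<N (liveVec t) (λ _ → h))))

-- Boolean tests and finite sums

∧-intro : ∀ {a b} → T a → T b → T (a ∧ b)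
∧-intro x y = Equivalence.from T-∧ (x , y)

∧-elim : ∀ {a b} → T (a ∧ b) → T a × T b
∧-elim = Equivalence.to T-∧

⇒ᵇ-intro : ∀ {a b} → (T a → T b) → T (a ⇒ᵇ b)
⇒ᵇ-intro {false} f = tt
⇒ᵇ-intro {true} f = f tt

⇒ᵇ-elim : ∀ {a b} → T (a ⇒ᵇ b) → T a → T b
⇒ᵇ-elim {true} x _ = x

not-intro : ∀ {a} → ¬ T a → T (not a)
not-intro {false} f = tt
not-intro {true} f = f tt

not-elim : ∀ {a} → T (not a) → ¬ T a
not-elim {false} _ ()

allF-intro : ∀ {m} (p : Fin m → Bool) → (∀ i → T (p i)) → T (allF p)
allF-intro {m} p h = go (allFin m)
  where
  go : ∀ xs → T (foldr (λ i b → p i ∧ b) true xs)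
  go [] = tt
  go (x ∷ xs) = ∧-intro (h x) (go xs)

allF-elim : ∀ {m} (p : Fin m → Bool) → T (allF p) → ∀ i → T (p i)
allF-elim p h i = go h (∈-allFin i)
  where
  go : ∀ {xs} → T (foldr (λ i b → p i ∧ b) true xs) → i ∈ xs → T (p i)
  go h (here refl) = proj₁ (∧-elim h)
  go h (there i∈) = go (proj₂ (∧-elim h)) i∈

∑ : ∀ {m} → (Fin m → ℕ) → ℕ
∑ {m} f = sum (List.map f (allFin m))

∑-suc : ∀ {m} (f : Fin (suc m) → ℕ) → ∑ f ≡ f zero + ∑ (f ∘ suc)
∑-suc f = cong (λ xs → f zero + sum xs) (trans (map-tabulate suc f) (sym (map-tabulate id (f ∘ suc))))

∑-cong : ∀ {m} {f f' : Fin m → ℕ} → (∀ i → f i ≡ f' i) → ∑ f ≡ ∑ f'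
∑-cong eq = cong sum (map-cong eq (allFin _))

∑-zero : ∀ {m} {f : Fin m → ℕ} → (∀ i → f i ≡ 0) → ∑ f ≡ 0
∑-zero {zero} eq = refl
∑-zero {suc m} {f} eq = trans (∑-suc f) (cong₂ _+_ (eq zero) (∑-zero (eq ∘ suc)))

∑-+ : ∀ {m} (f f' : Fin m → ℕ) → ∑ (λ i → f i + f' i) ≡ ∑ f + ∑ f'
∑-+ {zero} f f' = refl
∑-+ {suc m} f f' = trans (∑-suc (λ i → f i + f' i)) (trans (cong (f zero + f' zero +_) (∑-+ (f ∘ suc) (f' ∘ suc)))
  (trans (interchange (f zero) (f' zero) _ _) (sym (cong₂ _+_ (∑-suc f) (∑-suc f')))))
  where
  open import Algebra.Properties.CommutativeSemigroup ℕ.+-commutativeSemigroup using (interchange)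

-- The staircase conditions, one column at a time

rowLive : ∀ {n} → Vec Cell n → Bool
rowLive [] = false
rowLive (c ∷ cs) = live∷ c (rowLive cs)

entry : ∀ {n N} → Vec (Vec Cell n) N → Fin N → Fin n → Cell
entry t r c = lookup (lookup t r) c

entry-zero : ∀ {n N} (t : Vec (Vec Cell (suc n)) N) r → entry t r zero ≡ lookup (map head t) r
entry-zero ((x ∷ xs) ∷ t) zero = refl
entry-zero (_ ∷ t) (suc r) = entry-zero t r

entry-suc : ∀ {n N} (t : Vec (Vec Cell (suc n)) N) r c → entry t r (suc c) ≡ entry (map tail t) r c
entry-suc ((x ∷ xs) ∷ t) zero c = refl
entry-suc (_ ∷ t) (suc r) c = entry-suc t r c

liveVec-row : ∀ {n N} (t : Vec (Vec Cell n) N) r → lookup (liveVec t) r ≡ rowLive (lookup t r)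
liveVec-row {zero} t r with lookup t r
... | [] = lookup-replicate r false
liveVec-row {suc n} t r = trans (lookup-zipWith live∷ r (map head t) (liveVec (map tail t)))
  (trans (cong (live∷ (lookup (map head t) r)) (liveVec-row (map tail t) r)) (row t r))
  where
  row : ∀ {N} (t : Vec (Vec Cell (suc n)) N) r → live∷ (lookup (map head t) r) (rowLive (lookup (map tail t) r)) ≡ rowLive (lookup t r)
  row ((x ∷ xs) ∷ t) zero = refl
  row (_ ∷ t) (suc r) = row t r

β-if-dead : ∀ {n} (cs : Vec Cell n) c → lookup cs c ≢ ○ → rowLive cs ≡ false → ∃ λ c' → T (isβδ (lookup cs c'))
β-if-dead (○ ∷ cs) zero ne dead = ⊥-elim (ne refl)
β-if-dead (○ ∷ cs) (suc c) ne dead with β-if-dead cs c ne dead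
... | c' , p = suc c' , p
β-if-dead (β ∷ cs) c ne dead = zero , tt
β-if-dead (δ ∷ cs) c ne dead = zero , tt

dead-if-β : ∀ {n} (cs : Vec Cell n) c → (∀ c' → toℕ c' < toℕ c → lookup cs c' ≡ ○) → T (isβδ (lookup cs c)) → rowLive cs ≡ false
dead-if-β (β ∷ cs) zero left p = refl
dead-if-β (δ ∷ cs) zero left p = refl
dead-if-β (x ∷ cs) (suc c) left p with x | left zero z<s
... | ○ | _ = dead-if-β cs c (λ c' lt → left (suc c') (s<s lt)) p

record Valid {n N} (t : Vec (Vec Cell n) N) : Set where
  field
    outside : ∀ r c → n ≤ toℕ r + toℕ c → entry t r c ≡ ○
    diagonal : ∀ r c → suc (toℕ r + toℕ c) ≡ n → entry t r c ≢ ○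
    left : ∀ r c c' → toℕ c' < toℕ c → T (isβδ (entry t r c)) → entry t r c' ≡ ○
    above : ∀ r c r' → toℕ r' < toℕ r → T (isαγ (entry t r c)) → entry t r' c ≡ ○
    noδ : ∀ r c → entry t r c ≢ δ

-- The field `live` replaces the row condition of `Valid`: what lies to the right of the column
-- matters only through which rows are live.
record ColValid {N} (n : ℕ) (ls : Vec Bool N) (cs : Vec Cell N) : Set where
  field
    outside : ∀ r → n < toℕ r → lookup cs r ≡ ○
    diagonal : ∀ r → toℕ r ≡ n → lookup cs r ≢ ○
    live : ∀ r → toℕ r < n → lookup cs r ≢ ○ → T (lookup ls r)
    above : ∀ r r' → toℕ r' < toℕ r → T (isαγ (lookup cs r)) → lookup cs r' ≡ ○
    noδ : ∀ r → lookup cs r ≢ δ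

allEmpty-elim : ∀ {N} (cs : Vec Cell N) → T (allEmpty cs) → ∀ r → lookup cs r ≡ ○
allEmpty-elim (○ ∷ cs) p zero = refl
allEmpty-elim (○ ∷ cs) p (suc r) = allEmpty-elim cs p r

allEmpty-intro : ∀ {N} (cs : Vec Cell N) → (∀ r → lookup cs r ≡ ○) → T (allEmpty cs)
allEmpty-intro [] h = tt
allEmpty-intro (c ∷ cs) h rewrite h zero = allEmpty-intro cs (h ∘ suc)

label-αγ : ∀ {N} (cs : Vec Cell N) r → (∀ r' → toℕ r' < toℕ r → lookup cs r' ≡ ○) → T (isαγ (lookup cs r)) → ¬ T (isJustβ (label cs))
label-αγ (α ∷ cs) zero top p ()
label-αγ (γ ∷ cs) zero top p ()
label-αγ (x ∷ cs) (suc r) top p with x | top zero z<s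
... | ○ | _ = label-αγ cs r (λ r' lt → top (suc r') (s<s lt)) p

label-β : ∀ {N} (cs : Vec Cell N) r → lookup cs r ≢ ○ → (∀ r → lookup cs r ≢ δ) → (∀ r → ¬ T (isαγ (lookup cs r))) → T (isJustβ (label cs))
label-β (○ ∷ cs) zero ne nδ nαγ = ⊥-elim (ne refl)
label-β (○ ∷ cs) (suc r) ne nδ nαγ = label-β cs r ne (nδ ∘ suc) (nαγ ∘ suc)
label-β (α ∷ cs) r ne nδ nαγ = ⊥-elim (nαγ zero tt)
label-β (β ∷ cs) r ne nδ nαγ = tt
label-β (γ ∷ cs) r ne nδ nαγ = ⊥-elim (nαγ zero tt)
label-β (δ ∷ cs) r ne nδ nαγ = ⊥-elim (nδ zero refl)

okCell-label : ∀ l b c → c ≢ ○ → T (okCell l b c) → T l × T (isJustβ b)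
okCell-label l b ○ ne p = ⊥-elim (ne refl)
okCell-label l b α ne p = ∧-elim p
okCell-label l b β ne p = ∧-elim p
okCell-label l b γ ne p = ∧-elim p

okCell-noδ : ∀ {l b c} → T (okCell l b c) → c ≢ δ
okCell-noδ () refl

okCell-intro : ∀ l b c → c ≢ δ → (c ≢ ○ → T l × T (isJustβ b)) → T (okCell l b c)
okCell-intro l b ○ nδ h = tt
okCell-intro l b α nδ h = let x , y = h (λ ()) in ∧-intro x y
okCell-intro l b β nδ h = let x , y = h (λ ()) in ∧-intro x y
okCell-intro l b γ nδ h = let x , y = h (λ ()) in ∧-intro x y
okCell-intro l b δ nδ h = nδ refl

○? : ∀ c → ¬ (c ≢ ○) → c ≡ ○
○? ○ _ = refl
○? α h = ⊥-elim (h λ ())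
○? β h = ⊥-elim (h λ ())
○? γ h = ⊥-elim (h λ ())
○? δ h = ⊥-elim (h λ ())

isEmpty⇒≡ : ∀ c → T (isEmpty c) → c ≡ ○
isEmpty⇒≡ ○ _ = refl

≡⇒isEmpty : ∀ {c} → c ≡ ○ → T (isEmpty c)
≡⇒isEmpty refl = tt

colOK⇒ColValid : ∀ {N} n (ls : Vec Bool N) cs → T (colOK n ls cs) → ColValid n ls cs
colOK⇒ColValid n [] [] _ = record
  { outside = λ () ; diagonal = λ () ; live = λ () ; above = λ () ; noδ = λ () }
colOK⇒ColValid zero (l ∷ ls) (c ∷ cs) p = record
  { outside = λ { (suc r) _ → empty-below r }
  ; diagonal = λ { zero _ e → not-elim (proj₁ diag-ok) (≡⇒isEmpty e) }
  ; live = λ _ ()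
  ; above = λ { (suc r) r' _ q → ⊥-elim (subst (T ∘ isαγ) (empty-below r) q) }
  ; noδ = λ { zero e → not-elim {isδ c} (proj₂ diag-ok) (subst (T ∘ isδ) (sym e) tt)
            ; (suc r) eq → contradiction (trans (sym (empty-below r)) eq) λ () } }
  where
  p' = ∧-elim {okDiag c} p
  diag-ok = ∧-elim {not (isEmpty c)} {not (isδ c)} (proj₁ p')
  empty-below = allEmpty-elim cs (proj₂ p')
colOK⇒ColValid (suc n) (l ∷ ls) (c ∷ cs) p = record
  { outside = λ { (suc r) (s≤s lt) → V.outside r lt }
  ; diagonal = λ { (suc r) eq → V.diagonal r (ℕ.suc-injective eq) }
  ; live = λ { zero _ ne → proj₁ (okCell-label l (label cs) c ne (proj₁ p'))
             ; (suc r) (s≤s lt) → V.live r lt }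
  -- A label in the top box needs a β as the nearest label below; but everything above an α or γ in
  -- `cs` is empty, so that α or γ would be the nearest.
  ; above = λ { (suc r) zero _ q → ○? c (λ ne →
                  label-αγ cs r (λ r' lt → V.above r r' lt q) q (proj₂ (okCell-label l (label cs) c ne (proj₁ p'))))
              ; (suc r) (suc r') (s≤s lt) → V.above r r' lt }
  ; noδ = λ { zero → okCell-noδ {l} {label cs} (proj₁ p') ; (suc r) → V.noδ r } }
  where
  p' = ∧-elim {okCell l (label cs) c} p
  module V = ColValid (colOK⇒ColValid n ls cs (proj₂ p'))

ColValid⇒colOK : ∀ {N} n → n < N → (ls : Vec Bool N) → ∀ cs → ColValid n ls cs → T (colOK n ls cs)
ColValid⇒colOK zero _ (l ∷ ls) (c ∷ cs) v =
  ∧-intro (okDiag-intro c (V.diagonal zero refl) (V.noδ zero)) (allEmpty-intro cs (λ r → V.outside (suc r) z<s))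
  where
  module V = ColValid v
  okDiag-intro : ∀ c → c ≢ ○ → c ≢ δ → T (okDiag c)
  okDiag-intro ○ ne nδ = ne refl
  okDiag-intro α ne nδ = tt
  okDiag-intro β ne nδ = tt
  okDiag-intro γ ne nδ = tt
  okDiag-intro δ ne nδ = nδ refl
ColValid⇒colOK (suc n) (s≤s n<N) (l ∷ ls) (c ∷ cs) v = ∧-intro
  (okCell-intro l (label cs) c (V.noδ zero) λ ne → V.live zero z<s ne ,
    -- The diagonal box guarantees a label below the top box, and an α or γ anywhere below would
    -- force the top box to be empty.
    label-β cs (fromℕ< n<N) (V.diagonal (suc (fromℕ< n<N)) (cong suc (toℕ-fromℕ< n<N)))
      (V.noδ ∘ suc) (λ r q → ne (V.above (suc r) zero z<s q)))
  (ColValid⇒colOK n n<N ls cs record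
    { outside = λ r lt → V.outside (suc r) (s≤s lt)
    ; diagonal = λ r eq → V.diagonal (suc r) (cong suc eq)
    ; live = λ r lt → V.live (suc r) (s≤s lt)
    ; above = λ r r' lt → V.above (suc r) (suc r') (s≤s lt)
    ; noδ = V.noδ ∘ suc })
  where
  module V = ColValid v

module _ {n N} (t : Vec (Vec Cell (suc n)) N) where
  private
    t' = map tail t
    cs = map head t
    e0 = entry-zero t
    es = entry-suc t

  Valid-tail : Valid t → Valid t'
  Valid-tail v = record
    { outside = λ r c le → trans (sym (es r c)) (V.outside r (suc c) (subst (suc n ≤_) (sym (ℕ.+-suc (toℕ r) (toℕ c))) (s≤s le)))
    ; diagonal = λ r c eq p → V.diagonal r (suc c) (cong suc (trans (ℕ.+-suc (toℕ r) (toℕ c)) eq)) (trans (es r c) p)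
    ; left = λ r c c' lt p → trans (sym (es r c')) (V.left r (suc c) (suc c') (s≤s lt) (subst (T ∘ isβδ) (sym (es r c)) p))
    ; above = λ r c r' lt p → trans (sym (es r' c)) (V.above r (suc c) r' lt (subst (T ∘ isαγ) (sym (es r c)) p))
    ; noδ = λ r c p → V.noδ r (suc c) (trans (es r c) p) }
    where module V = Valid v

  Valid-head : Valid t → ColValid n (liveVec t') cs
  Valid-head v = record
    { outside = λ r lt → trans (sym (e0 r)) (V.outside r zero (ℕ.≤-trans lt (ℕ.m≤m+n (toℕ r) 0)))
    ; diagonal = λ r eq p → V.diagonal r zero (cong suc (trans (ℕ.+-identityʳ _) eq)) (trans (e0 r) p)
    ; live = live
    ; above = λ r r' lt p → trans (sym (e0 r')) (V.above r zero r' lt (subst (T ∘ isαγ) (sym (e0 r)) p))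
    ; noδ = λ r p → V.noδ r zero (trans (e0 r) p) }
    where
    module V = Valid v
    live : ∀ r → toℕ r < n → lookup cs r ≢ ○ → T (lookup (liveVec t') r)
    live r lt ne rewrite liveVec-row t' r with rowLive (lookup t' r) in eq
    ... | true = tt
    -- A dead row with index below n still has a label, for instance in its diagonal box, which is
    -- column n - r - 1 of `t'`. So some β or δ occurs in it and forbids the new label to its left.
    ... | false = ne (trans (sym (e0 r)) (V.left r (suc (proj₁ β-cell)) zero z<s (subst (T ∘ isβδ) (sym (es r _)) (proj₂ β-cell))))
      where
      d<n : n ∸ suc (toℕ r) < n
      d<n = ℕ.∸-monoʳ-< z<s lt
      d = fromℕ< d<n
      diag : toℕ r + suc (toℕ d) ≡ n
      diag = trans (cong (λ x → toℕ r + suc x) (toℕ-fromℕ< d<n)) (trans (ℕ.+-suc _ _) (ℕ.m+[n∸m]≡n lt))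
      β-cell = β-if-dead (lookup t' r) d (λ p → V.diagonal r (suc d) (cong suc diag) (trans (es r d) p)) eq

  Valid-cons : Valid t' → ColValid n (liveVec t') cs → Valid t
  Valid-cons v w = record { outside = outside ; diagonal = diagonal ; left = left ; above = above ; noδ = noδ }
    where
    module V = Valid v
    module W = ColValid w
    outside : ∀ r c → suc n ≤ toℕ r + toℕ c → entry t r c ≡ ○
    outside r zero le = trans (e0 r) (W.outside r (subst (suc n ≤_) (ℕ.+-identityʳ _) le))
    outside r (suc c) le = trans (es r c) (V.outside r c (s≤s⁻¹ (subst (suc n ≤_) (ℕ.+-suc (toℕ r) (toℕ c)) le)))
    diagonal : ∀ r c → suc (toℕ r + toℕ c) ≡ suc n → entry t r c ≢ ○
    diagonal r zero eq p = W.diagonal r (trans (sym (ℕ.+-identityʳ _)) (ℕ.suc-injective eq)) (trans (sym (e0 r)) p)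
    diagonal r (suc c) eq p = V.diagonal r c (trans (sym (ℕ.+-suc (toℕ r) (toℕ c))) (ℕ.suc-injective eq)) (trans (sym (es r c)) p)
    left : ∀ r c c' → toℕ c' < toℕ c → T (isβδ (entry t r c)) → entry t r c' ≡ ○
    -- All boxes of `t'` to the left of this β or δ are empty, so it is the leftmost label and the
    -- row is dead; a label in the first column would require a live row.
    left r (suc c) zero _ p = trans (e0 r) (○? _ λ ne → subst T
      (trans (liveVec-row t' r) (dead-if-β (lookup t' r) c (λ c' lt → V.left r c c' lt p') p')) (W.live r r<n ne))
      where
      p' : T (isβδ (entry t' r c))
      p' = subst (T ∘ isβδ) (es r c) p
      r<n : toℕ r < n
      r<n = ℕ.≰⇒> λ n≤r → subst (T ∘ isβδ) (V.outside r c (ℕ.≤-trans n≤r (ℕ.m≤m+n _ _))) p'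
    left r (suc c) (suc c') (s≤s lt) p = trans (es r c') (V.left r c c' lt (subst (T ∘ isβδ) (es r c) p))
    above : ∀ r c r' → toℕ r' < toℕ r → T (isαγ (entry t r c)) → entry t r' c ≡ ○
    above r zero r' lt p = trans (e0 r') (W.above r r' lt (subst (T ∘ isαγ) (e0 r) p))
    above r (suc c) r' lt p = trans (es r' c) (V.above r c r' lt (subst (T ∘ isαγ) (es r c) p))
    noδ : ∀ r c → entry t r c ≢ δ
    noδ r zero p = W.noδ r (trans (sym (e0 r)) p)
    noδ r (suc c) p = V.noδ r c (trans (sym (es r c)) p)

valid⇒Valid : ∀ {n N} (t : Vec (Vec Cell n) N) → T (valid t) → Valid t
valid⇒Valid {zero} t _ = record
  { outside = λ _ () ; diagonal = λ _ () ; left = λ _ () ; above = λ _ () ; noδ = λ _ () }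
valid⇒Valid {suc n} t p = Valid-cons t (valid⇒Valid (map tail t) (proj₂ p')) (colOK⇒ColValid n _ _ (proj₁ p'))
  where p' = ∧-elim {colOK n (liveVec (map tail t)) (map head t)} p

Valid⇒valid : ∀ {n N} → n ≤ N → (t : Vec (Vec Cell n) N) → Valid t → T (valid t)
Valid⇒valid {zero} _ t _ = tt
Valid⇒valid {suc n} n<N t v = ∧-intro (ColValid⇒colOK n n<N _ _ (Valid-head t v)) (Valid⇒valid (ℕ.<⇒≤ n<N) (map tail t) (Valid-tail t v))

isδ⇒≡ : ∀ c → T (isδ c) → c ≡ δ
isδ⇒≡ δ _ = refl

module _ {n} (t : Filling n) where
  private
    outsideᵇ diagonalᵇ δᵇ : Fin n → Fin n → Bool
    outsideᵇ r c = not (inShape r c) ⇒ᵇ isEmpty (cell t r c)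
    diagonalᵇ r c = isDiag r c ⇒ᵇ not (isEmpty (cell t r c))
    δᵇ r c = not (isδ (cell t r c))
    leftᵇ aboveᵇ : Fin n → Fin n → Fin n → Bool
    leftᵇ r c c' = (isβδ (cell t r c) ∧ (c' <F c)) ⇒ᵇ isEmpty (cell t r c')
    aboveᵇ r c r' = (isαγ (cell t r c) ∧ (r' <F r)) ⇒ᵇ isEmpty (cell t r' c)
    all₁ : (Fin n → Fin n → Bool) → Bool
    all₁ p = allF λ r → allF λ c → p r c
    all₂ : (Fin n → Fin n → Fin n → Bool) → Bool
    all₂ p = all₁ λ r c → allF λ i → p r c i
    all₁-elim : ∀ p → T (all₁ p) → ∀ r c → T (p r c)
    all₁-elim p h r c = allF-elim (p r) (allF-elim (λ r → allF (p r)) h r) c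
    all₁-intro : ∀ p → (∀ r c → T (p r c)) → T (all₁ p)
    all₁-intro p h = allF-intro (λ r → allF (p r)) λ r → allF-intro (p r) (h r)
    all₂-elim : ∀ p → T (all₂ p) → ∀ r c i → T (p r c i)
    all₂-elim p h r c = allF-elim (p r c) (all₁-elim (λ r c → allF (p r c)) h r c)
    all₂-intro : ∀ p → (∀ r c i → T (p r c i)) → T (all₂ p)
    all₂-intro p h = all₁-intro (λ r c → allF (p r c)) λ r c → allF-intro (p r c) (h r c)

  staircase⇒Valid : T (isStaircase t ∧ noDelta t) → Valid t
  staircase⇒Valid p = record
    { outside = λ r c le → isEmpty⇒≡ _ (⇒ᵇ-elim (all₁-elim outsideᵇ (proj₁ h₁) r c)
        (not-intro λ lt → ℕ.≤⇒≯ le (ℕ.<ᵇ⇒< _ _ lt)))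
    ; diagonal = λ r c eq e → not-elim (⇒ᵇ-elim (all₁-elim diagonalᵇ (proj₁ h₂) r c) (ℕ.≡⇒≡ᵇ _ _ eq)) (≡⇒isEmpty e)
    ; left = λ r c c' lt q → isEmpty⇒≡ _ (⇒ᵇ-elim (all₂-elim leftᵇ (proj₁ h₃) r c c') (∧-intro q (ℕ.<⇒<ᵇ lt)))
    ; above = λ r c r' lt q → isEmpty⇒≡ _ (⇒ᵇ-elim (all₂-elim aboveᵇ (proj₂ h₃) r c r') (∧-intro q (ℕ.<⇒<ᵇ lt)))
    ; noδ = λ r c e → not-elim {isδ (cell t r c)} (all₁-elim δᵇ (proj₂ h₀) r c) (subst (T ∘ isδ) (sym e) tt) }
    where
    h₀ = ∧-elim {isStaircase t} p
    h₁ = ∧-elim {all₁ outsideᵇ} (proj₁ h₀)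
    h₂ = ∧-elim {all₁ diagonalᵇ} (proj₂ h₁)
    h₃ = ∧-elim {all₂ leftᵇ} (proj₂ h₂)

  Valid⇒staircase : Valid t → T (isStaircase t ∧ noDelta t)
  Valid⇒staircase v = ∧-intro {isStaircase t}
    (∧-intro {all₁ outsideᵇ} (all₁-intro outsideᵇ λ r c → ⇒ᵇ-intro λ x →
        ≡⇒isEmpty (V.outside r c (ℕ.≮⇒≥ λ lt → not-elim x (ℕ.<⇒<ᵇ lt))))
    (∧-intro {all₁ diagonalᵇ} (all₁-intro diagonalᵇ λ r c → ⇒ᵇ-intro λ x →
        not-intro λ e → V.diagonal r c (ℕ.≡ᵇ⇒≡ _ _ x) (isEmpty⇒≡ _ e))
    (∧-intro {all₂ leftᵇ} (all₂-intro leftᵇ λ r c c' → ⇒ᵇ-intro λ x → let q , lt = ∧-elim {isβδ (cell t r c)} x in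
        ≡⇒isEmpty (V.left r c c' (ℕ.<ᵇ⇒< _ _ lt) q))
      (all₂-intro aboveᵇ λ r c r' → ⇒ᵇ-intro λ x → let q , lt = ∧-elim {isαγ (cell t r c)} x in
        ≡⇒isEmpty (V.above r c r' (ℕ.<ᵇ⇒< _ _ lt) q)))))
    (all₁-intro δᵇ λ r c → not-intro λ e → V.noδ r c (isδ⇒≡ _ e))
    where module V = Valid v

-- The weight of a tableau, one column at a time

𝟙[_] : Bool → ℕ
𝟙[ b ] = if b then 1 else 0

∑-∑-suc : ∀ {N n} (f : Fin N → Fin (suc n) → ℕ) →
  ∑ (λ r → ∑ (f r)) ≡ ∑ (λ r → f r zero) + ∑ (λ r → ∑ (λ c → f r (suc c)))
∑-∑-suc f = trans (∑-cong (λ r → ∑-suc (f r))) (∑-+ (λ r → f r zero) (λ r → ∑ (λ c → f r (suc c))))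

count : ∀ {n N} → (Cell → Bool) → Vec (Vec Cell n) N → ℕ
count p t = ∑ λ r → ∑ λ c → 𝟙[ p (entry t r c) ]

count-suc : ∀ {n N} p (t : Vec (Vec Cell (suc n)) N) →
  count p t ≡ ∑ (λ r → 𝟙[ p (lookup (map head t) r) ]) + count p (map tail t)
count-suc p t = trans (∑-∑-suc (λ r c → 𝟙[ p (entry t r c) ])) (cong₂ _+_
  (∑-cong λ r → cong (𝟙[_] ∘ p) (entry-zero t r))
  (∑-cong λ r → ∑-cong λ c → cong (𝟙[_] ∘ p) (entry-suc t r c)))

q-test : ∀ {n N} → Vec (Vec Cell n) N → Fin N → Fin n → Bool
q-test {n} t r c = (toℕ r + toℕ c <ᵇ n) ∧ isEmpty (entry t r c) ∧
  weightIsQ (firstLabel (drop (suc (toℕ c)) (toList (lookup t r))))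
            (firstLabel (drop (suc (toℕ r)) (toList (map (λ row → lookup row c) t))))

q-boxes : ∀ {n N} → Vec (Vec Cell n) N → ℕ
q-boxes t = ∑ λ r → ∑ λ c → 𝟙[ q-test t r c ]

q-test-suc : ∀ {n N} (t : Vec (Vec Cell (suc n)) N) r c → q-test t r (suc c) ≡ q-test (map tail t) r c
q-test-suc {n} t r c = cong₂ _∧_ (cong (_<ᵇ suc n) (ℕ.+-suc (toℕ r) (toℕ c)))
  (cong₂ _∧_ (cong isEmpty (entry-suc t r c)) (cong₂ weightIsQ
    (cong firstLabel (row t r)) (cong (λ xs → firstLabel (drop (suc (toℕ r)) xs)) (col t))))
  where
  row : ∀ {N} (t : Vec (Vec Cell (suc n)) N) r →
    drop (suc (suc (toℕ c))) (toList (lookup t r)) ≡ drop (suc (toℕ c)) (toList (lookup (map tail t) r))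
  row ((x ∷ xs) ∷ t) zero = refl
  row (_ ∷ t) (suc r) = row t r
  col : ∀ {N} (t : Vec (Vec Cell (suc n)) N) →
    toList (map (λ row → lookup row (suc c)) t) ≡ toList (map (λ row → lookup row c) (map tail t))
  col [] = refl
  col ((x ∷ xs) ∷ t) = cong (lookup xs c ∷_) (col t)

-- Without δ, a label on the right is β, giving weight 1 whatever is below, or α or γ, and then the
-- two give the same weights. One bit per row is thus enough information.
weightIsQ-rowLive : ∀ {n} (cs : Vec Cell n) b → (∀ c → lookup cs c ≢ δ) → weightIsQ (label cs) b ≡ rowLive cs ∧ isJustβγ b
weightIsQ-rowLive [] b nδ = refl
weightIsQ-rowLive (○ ∷ cs) b nδ = weightIsQ-rowLive cs b (nδ ∘ suc)
weightIsQ-rowLive (α ∷ cs) nothing nδ = refl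
weightIsQ-rowLive (α ∷ cs) (just ○) nδ = refl
weightIsQ-rowLive (α ∷ cs) (just α) nδ = refl
weightIsQ-rowLive (α ∷ cs) (just β) nδ = refl
weightIsQ-rowLive (α ∷ cs) (just γ) nδ = refl
weightIsQ-rowLive (α ∷ cs) (just δ) nδ = refl
weightIsQ-rowLive (β ∷ cs) b nδ = refl
weightIsQ-rowLive (γ ∷ cs) nothing nδ = refl
weightIsQ-rowLive (γ ∷ cs) (just ○) nδ = refl
weightIsQ-rowLive (γ ∷ cs) (just α) nδ = refl
weightIsQ-rowLive (γ ∷ cs) (just β) nδ = refl
weightIsQ-rowLive (γ ∷ cs) (just γ) nδ = refl
weightIsQ-rowLive (γ ∷ cs) (just δ) nδ = refl
weightIsQ-rowLive (δ ∷ cs) b nδ = ⊥-elim (nδ zero refl)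

col-test : ∀ {N} → ℕ → Vec Bool N → Vec Cell N → Fin N → Bool
col-test n ls cs r = (toℕ r + 0 <ᵇ suc n) ∧ isEmpty (lookup cs r) ∧
  (lookup ls r ∧ isJustβγ (firstLabel (drop (suc (toℕ r)) (toList cs))))

q-test-zero : ∀ {n N} (t : Vec (Vec Cell (suc n)) N) → Valid (map tail t) → ∀ r →
  q-test t r zero ≡ col-test n (liveVec (map tail t)) (map head t) r
q-test-zero {n} t v r = cong ((toℕ r + 0 <ᵇ suc n) ∧_) (cong₂ _∧_ (cong isEmpty (entry-zero t r))
  (trans (cong₂ weightIsQ (cong firstLabel (row t r)) (cong (λ xs → firstLabel (drop (suc (toℕ r)) xs)) (col t)))
  (trans (weightIsQ-rowLive (lookup (map tail t) r) _ (Valid.noδ v r))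
    (cong (_∧ isJustβγ (firstLabel (drop (suc (toℕ r)) (toList (map head t))))) (sym (liveVec-row (map tail t) r))))))
  where
  row : ∀ {N} (t : Vec (Vec Cell (suc n)) N) r → drop 1 (toList (lookup t r)) ≡ toList (lookup (map tail t) r)
  row ((x ∷ xs) ∷ t) zero = refl
  row (_ ∷ t) (suc r) = row t r
  col : ∀ {N} (t : Vec (Vec Cell (suc n)) N) → toList (map (λ row → lookup row zero) t) ≡ toList (map head t)
  col [] = refl
  col ((x ∷ xs) ∷ t) = cong (x ∷_) (col t)

column-weight : ∀ {N} n (ls : Vec Bool N) cs → T (colOK n ls cs) →
  ⟨ ∑ (λ r → 𝟙[ col-test n ls cs r ]) , ∑ (λ r → 𝟙[ isα (lookup cs r) ]) , ∑ (λ r → 𝟙[ isγ (lookup cs r) ]) ⟩ ≡ colWt n ls cs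
column-weight n [] [] _ = refl
column-weight zero (l ∷ ls) (c ∷ cs) p = trans
  (cong-⟨⟩ (trans (∑-suc (λ r → 𝟙[ col-test 0 (l ∷ ls) (c ∷ cs) r ])) (cong (𝟙[ isEmpty c ∧ (l ∧ isJustβγ (label cs)) ] +_) (∑-zero {f = λ r → 𝟙[ col-test 0 (l ∷ ls) (c ∷ cs) (suc r) ]} λ _ → refl)))
    (trans (∑-suc (λ r → 𝟙[ isα (lookup (c ∷ cs) r) ])) (cong (𝟙[ isα c ] +_) (∑-zero λ r → cong (𝟙[_] ∘ isα) (empty-below r))))
    (trans (∑-suc (λ r → 𝟙[ isγ (lookup (c ∷ cs) r) ])) (cong (𝟙[ isγ c ] +_) (∑-zero λ r → cong (𝟙[_] ∘ isγ) (empty-below r)))))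
  (diag c (proj₁ p'))
  where
  p' = ∧-elim {okDiag c} p
  empty-below = allEmpty-elim cs (proj₂ p')
  diag : ∀ c → T (okDiag c) →
    ⟨ 𝟙[ isEmpty c ∧ (l ∧ isJustβγ (label cs)) ] + 0 , 𝟙[ isα c ] + 0 , 𝟙[ isγ c ] + 0 ⟩ ≡ cellWt false nothing c
  diag α _ = refl
  diag β _ = refl
  diag γ _ = refl
column-weight (suc n) (l ∷ ls) (c ∷ cs) p = trans
  (cong-⟨⟩ (∑-suc (λ r → 𝟙[ col-test (suc n) (l ∷ ls) (c ∷ cs) r ]))
    (∑-suc (λ r → 𝟙[ isα (lookup (c ∷ cs) r) ]))
    (∑-suc (λ r → 𝟙[ isγ (lookup (c ∷ cs) r) ])))
  (cong₂ _⊕_ (top c (proj₁ p')) (column-weight n ls cs (proj₂ p')))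
  where
  p' = ∧-elim {okCell l (label cs) c} p
  top : ∀ c → T (okCell l (label cs) c) →
    ⟨ 𝟙[ isEmpty c ∧ (l ∧ isJustβγ (label cs)) ] , 𝟙[ isα c ] , 𝟙[ isγ c ] ⟩ ≡ cellWt l (label cs) c
  top ○ _ with l ∧ isJustβγ (label cs)
  ... | true = refl
  ... | false = refl
  top α _ = refl
  top β _ = refl
  top γ _ = refl

tableau-weight : ∀ {n N} (t : Vec (Vec Cell n) N) → T (valid t) → ⟨ q-boxes t , count isα t , count isγ t ⟩ ≡ tabWt t
tableau-weight {zero} {N} t _ = cong-⟨⟩ (∑-zero {N} λ _ → refl) (∑-zero {N} λ _ → refl) (∑-zero {N} λ _ → refl)
tableau-weight {suc n} t p = trans
  (cong-⟨⟩
    (trans (∑-∑-suc (λ r c → 𝟙[ q-test t r c ])) (cong₂ _+_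
      (∑-cong λ r → cong 𝟙[_] (q-test-zero t (valid⇒Valid t' (proj₂ p')) r))
      (∑-cong λ r → ∑-cong λ c → cong 𝟙[_] (q-test-suc t r c))))
    (count-suc isα t) (count-suc isγ t))
  (cong₂ _⊕_ (column-weight n (liveVec t') (map head t) (proj₁ p')) (tableau-weight t' (proj₂ p')))
  where
  t' = map tail t
  p' = ∧-elim {colOK n (liveVec t') (map head t)} p

-- Matchings

punchIn-<ᵇ : ∀ {m} (i : Fin (suc m)) j k → (toℕ (punchIn i j) <ᵇ toℕ (punchIn i k)) ≡ (toℕ j <ᵇ toℕ k)
punchIn-<ᵇ zero j k = refl
punchIn-<ᵇ (suc i) zero zero = refl
punchIn-<ᵇ (suc i) zero (suc k) = refl
punchIn-<ᵇ (suc i) (suc j) zero = refl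
punchIn-<ᵇ (suc i) (suc j) (suc k) = punchIn-<ᵇ i j k

punchIn-<ᵇ-i : ∀ {m} (i : Fin (suc m)) k → (toℕ (punchIn i k) <ᵇ toℕ i) ≡ (toℕ k <ᵇ toℕ i)
punchIn-<ᵇ-i zero k = refl
punchIn-<ᵇ-i (suc i) zero = refl
punchIn-<ᵇ-i (suc i) (suc k) = punchIn-<ᵇ-i i k

i-<ᵇ-punchIn : ∀ {m} (i : Fin (suc m)) k → (toℕ i <ᵇ toℕ (punchIn i k)) ≡ (toℕ i <ᵇ suc (toℕ k))
i-<ᵇ-punchIn zero k = refl
i-<ᵇ-punchIn (suc i) zero = refl
i-<ᵇ-punchIn (suc i) (suc k) = i-<ᵇ-punchIn i k

punchIn-<ᵇ-suc : ∀ {m} (i : Fin (suc m)) k {n} → toℕ i ≤ n → (toℕ (punchIn i k) <ᵇ suc n) ≡ (toℕ k <ᵇ n)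
punchIn-<ᵇ-suc zero k _ = refl
punchIn-<ᵇ-suc (suc i) zero (s≤s _) = refl
punchIn-<ᵇ-suc (suc i) (suc k) (s≤s le) = punchIn-<ᵇ-suc i k le

toℕ-punchIn-< : ∀ {m} (i : Fin (suc m)) k → toℕ k < toℕ i → toℕ (punchIn i k) ≡ toℕ k
toℕ-punchIn-< (suc i) zero _ = refl
toℕ-punchIn-< (suc i) (suc k) (s≤s lt) = cong suc (toℕ-punchIn-< i k lt)

∑-punchIn : ∀ {m} (i : Fin (suc m)) (f : Fin (suc m) → ℕ) → ∑ f ≡ f i + ∑ (f ∘ punchIn i)
∑-punchIn zero f = ∑-suc f
∑-punchIn {suc m} (suc i) f = trans (∑-suc f) (trans (cong (f zero +_) (∑-punchIn i (f ∘ suc)))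
  (trans (x∙yz≈y∙xz (f zero) (f (suc i)) _) (cong (f (suc i) +_) (sym (∑-suc (f ∘ punchIn (suc i)))))))
  where open import Algebra.Properties.CommutativeSemigroup ℕ.+-commutativeSemigroup using (x∙yz≈y∙xz)

∑-< : ∀ {m} h → h ≤ m → ∑ {m} (λ k → 𝟙[ toℕ k <ᵇ h ]) ≡ h
∑-< {m} zero _ = ∑-zero {m} λ _ → refl
∑-< {suc m} (suc h) (s≤s h≤m) = trans (∑-suc {m} (λ k → 𝟙[ toℕ k <ᵇ suc h ])) (cong suc (∑-< h h≤m))

∑-between : ∀ {m} i h → h ≤ m → ∑ {m} (λ k → 𝟙[ (i <ᵇ suc (toℕ k)) ∧ (toℕ k <ᵇ h) ]) ≡ h ∸ i
∑-between {m} zero h h≤m = ∑-< h h≤m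
∑-between {m} (suc i) zero h≤m = ∑-zero {m} {λ k → 𝟙[ (suc i <ᵇ suc (toℕ k)) ∧ false ]} λ k → no-lt (suc i <ᵇ suc (toℕ k))
  where
  no-lt : ∀ b → 𝟙[ b ∧ false ] ≡ 0
  no-lt false = refl
  no-lt true = refl
∑-between {suc m} (suc i) (suc h) (s≤s h≤m) =
  trans (∑-suc {m} (λ k → 𝟙[ (suc i <ᵇ suc (toℕ k)) ∧ (toℕ k <ᵇ suc h) ])) (∑-between i h h≤m)

𝟙-false : ∀ {b} → ¬ T b → 𝟙[ b ] ≡ 0
𝟙-false {false} _ = refl
𝟙-false {true} h = ⊥-elim (h tt)

∧-absorbʳ : ∀ {a b} → (T a → T b) → a ∧ b ≡ a
∧-absorbʳ {false} _ = refl
∧-absorbʳ {true} {true} _ = refl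
∧-absorbʳ {true} {false} h = ⊥-elim (h tt)

if-cong : ∀ {b b' : Bool} {x x' : ℕ} → b ≡ b' → (T b' → x ≡ x') → (if b then x else 0) ≡ (if b' then x' else 0)
if-cong {false} refl _ = refl
if-cong {true} refl h = h tt

∧-congʳ-T : ∀ {b b' c c' : Bool} → b ≡ b' → (T b' → c ≡ c') → b ∧ c ≡ b' ∧ c'
∧-congʳ-T {false} refl _ = refl
∧-congʳ-T {true} refl h = h tt

<ᵇ→< : ∀ {m n} → T (m <ᵇ n) → m < n
<ᵇ→< = ℕ.<ᵇ⇒< _ _

-- The edges at the first h points end at or after the point h: they are still open when h is reached.
record Matching {m} (h : ℕ) (p : Fin m → Fin m) : Set where
  field
    involutive : ∀ i → p (p i) ≡ i
    irreflexive : ∀ i → p i ≢ i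
    open-below : ∀ i → toℕ i < h → h ≤ toℕ (p i)

edgeWt : ℕ → ℕ → Weight
edgeWt c d = ⟨ (if 0 <ᵇ d then c else ⌊ c /2⌋) , 𝟙[ c <ᵇ d ] , 𝟙[ d <ᵇ c ] ⟩

matchingWt : ∀ {m} → Partner m → Weight
matchingWt p = ⟨ totalFCross p , nestedEdges p , crossedEdges p ⟩

crossTerm nestTerm : ∀ {m} → Partner m → Fin m → Fin m → ℕ
crossTerm p i l = 𝟙[ (i <F l) ∧ (l <F lookup p i) ∧ (lookup p i <F lookup p l) ]
nestTerm p i l = 𝟙[ (l <F i) ∧ (lookup p i <F lookup p l) ]

-- The point y with toℕ y = h + 1 closes an edge opened at x; emb lists the remaining points in order.
module Remove {m h : ℕ} (h≤m : h ≤ m) (y : Fin (suc (suc m))) (y≡ : toℕ y ≡ suc h)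
  (x' : Fin (suc m)) (x'≤h : toℕ x' ≤ h) where

  x : Fin (suc (suc m))
  x = punchIn y x'

  emb : Fin m → Fin (suc (suc m))
  emb k = punchIn y (punchIn x' k)

  data View : Fin (suc (suc m)) → Set where
    at-x : View x
    at-y : View y
    at-emb : ∀ k → View (emb k)

  view : ∀ z → View z
  view z with y ≟ z
  ... | yes refl = at-y
  ... | no y≢z with x' ≟ punchOut y≢z in eq
  ...   | yes refl = subst View (punchIn-punchOut y≢z) at-x
  ...   | no x'≢ = subst View (trans (cong (punchIn y) (punchIn-punchOut x'≢)) (punchIn-punchOut y≢z)) (at-emb (punchOut x'≢))

  emb-injective : ∀ {k k'} → emb k ≡ emb k' → k ≡ k'
  emb-injective eq = punchIn-injective x' _ _ (punchIn-injective y _ _ eq)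

  emb≢y : ∀ {k} → emb k ≢ y
  emb≢y = punchInᵢ≢i y _

  emb≢x : ∀ {k} → emb k ≢ x
  emb≢x eq = punchInᵢ≢i x' _ (punchIn-injective y _ _ eq)

  x≢y : x ≢ y
  x≢y = punchInᵢ≢i y x'

  x≡ : toℕ x ≡ toℕ x'
  x≡ = toℕ-punchIn-< y x' (subst (toℕ x' <_) (sym y≡) (s≤s x'≤h))

  x<y : toℕ x < toℕ y
  x<y rewrite x≡ | y≡ = s≤s x'≤h

  emb-<ᵇ : ∀ j k → (emb j <F emb k) ≡ (j <F k)
  emb-<ᵇ j k = trans (punchIn-<ᵇ y _ _) (punchIn-<ᵇ x' j k)

  emb-<ᵇ-y : ∀ k → (emb k <F y) ≡ (toℕ k <ᵇ h)
  emb-<ᵇ-y k = trans (punchIn-<ᵇ-i y _) (trans (cong (toℕ (punchIn x' k) <ᵇ_) y≡) (punchIn-<ᵇ-suc x' k x'≤h))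

  emb-<ᵇ-x : ∀ k → (emb k <F x) ≡ (toℕ k <ᵇ toℕ x')
  emb-<ᵇ-x k = trans (punchIn-<ᵇ y _ _) (punchIn-<ᵇ-i x' k)

  x-<ᵇ-emb : ∀ k → (x <F emb k) ≡ (toℕ x' <ᵇ suc (toℕ k))
  x-<ᵇ-emb k = trans (punchIn-<ᵇ y _ _) (i-<ᵇ-punchIn x' k)

  emb<y⇒ : ∀ {k} → toℕ (emb k) < toℕ y → toℕ k < h
  emb<y⇒ {k} lt = <ᵇ→< (subst T (emb-<ᵇ-y k) (ℕ.<⇒<ᵇ lt))

  ⇒emb<y : ∀ {k} → toℕ k < h → toℕ (emb k) < toℕ y
  ⇒emb<y {k} lt = <ᵇ→< (subst T (sym (emb-<ᵇ-y k)) (ℕ.<⇒<ᵇ lt))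

  ∑-split : ∀ f → ∑ f ≡ f y + (f x + ∑ (f ∘ emb))
  ∑-split f = trans (∑-punchIn y f) (cong (f y +_) (∑-punchIn x' (f ∘ punchIn y)))

  -- A relation rather than a function, used in both directions. By `unique-p` and `unique-q` each
  -- of `p` and `q` determines the other, so mutually inverse maps result as soon as each direction
  -- produces a related pair.
  record Removal (p : Fin (suc (suc m)) → Fin (suc (suc m))) (q : Fin m → Fin m) : Set where
    field
      p-y : p y ≡ x
      p-x : p x ≡ y
      p-emb : ∀ k → p (emb k) ≡ emb (q k)

  unique-p : ∀ {p p' q} → Removal p q → Removal p' q → ∀ z → p z ≡ p' z
  unique-p ρ ρ' z with view z
  ... | at-x = trans (Removal.p-x ρ) (sym (Removal.p-x ρ'))
  ... | at-y = trans (Removal.p-y ρ) (sym (Removal.p-y ρ'))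
  ... | at-emb k = trans (Removal.p-emb ρ k) (sym (Removal.p-emb ρ' k))

  unique-q : ∀ {p q q'} → Removal p q → Removal p q' → ∀ k → q k ≡ q' k
  unique-q ρ ρ' k = emb-injective (trans (sym (Removal.p-emb ρ k)) (Removal.p-emb ρ' k))

  insert : (Fin m → Fin m) → Fin (suc (suc m)) → Fin (suc (suc m))
  insert q z with view z
  ... | at-x = y
  ... | at-y = x
  ... | at-emb k = emb (q k)

  insert-Removal : ∀ q → Removal (insert q) q
  insert-Removal q = record { p-y = at-y⇒ y refl ; p-x = at-x⇒ x refl ; p-emb = λ k → at-emb⇒ (emb k) k refl }
    where
    at-y⇒ : ∀ z → z ≡ y → insert q z ≡ x
    at-y⇒ z eq with view z
    ... | at-x = contradiction eq x≢y
    ... | at-y = refl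
    ... | at-emb k = contradiction eq emb≢y
    at-x⇒ : ∀ z → z ≡ x → insert q z ≡ y
    at-x⇒ z eq with view z
    ... | at-x = refl
    ... | at-y = contradiction (sym eq) x≢y
    ... | at-emb k = contradiction eq emb≢x
    at-emb⇒ : ∀ z k → z ≡ emb k → insert q z ≡ emb (q k)
    at-emb⇒ z k eq with view z
    ... | at-x = contradiction (sym eq) emb≢x
    ... | at-y = contradiction (sym eq) emb≢y
    ... | at-emb k' = cong (emb ∘ q) (emb-injective eq)

  module _ {p q} (ρ : Removal p q) where
    open Removal ρ

    removed-Matching : Matching (suc h) p → Matching h q
    removed-Matching μ = record
      { involutive = λ k → emb-injective (trans (sym (trans (cong p (p-emb k)) (p-emb (q k)))) (involutive (emb k)))
      ; irreflexive = λ k eq → irreflexive (emb k) (trans (p-emb k) (cong emb eq))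
      ; open-below = λ k k<h → ℕ.≮⇒≥ λ qk<h → ℕ.<⇒≱
          (subst (toℕ (p (emb k)) <_) y≡ (subst (λ z → toℕ z < toℕ y) (sym (p-emb k)) (⇒emb<y qk<h)))
          (open-below (emb k) (subst (toℕ (emb k) <_) y≡ (⇒emb<y k<h))) }
      where open Matching μ

    inserted-Matching : Matching h q → Matching (suc h) p
    inserted-Matching μ = record { involutive = inv ; irreflexive = irr ; open-below = opn }
      where
      open Matching μ
      inv : ∀ z → p (p z) ≡ z
      inv z with view z
      ... | at-x = trans (cong p p-x) p-y
      ... | at-y = trans (cong p p-y) p-x
      ... | at-emb k = trans (cong p (p-emb k)) (trans (p-emb (q k)) (cong emb (involutive k)))
      irr : ∀ z → p z ≢ z
      irr z eq with view z
      ... | at-x = x≢y (trans (sym eq) p-x)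
      ... | at-y = x≢y (trans (sym p-y) eq)
      ... | at-emb k = irreflexive k (emb-injective (trans (sym (p-emb k)) eq))
      opn : ∀ z → toℕ z < suc h → suc h ≤ toℕ (p z)
      opn z z<y with view z
      ... | at-x = ℕ.≤-reflexive (trans (sym y≡) (cong toℕ (sym p-x)))
      ... | at-y = contradiction (subst (_< suc h) y≡ z<y) (ℕ.<-irrefl refl)
      ... | at-emb k = subst₂ _≤_ y≡ (cong toℕ (sym (p-emb k)))
        (ℕ.≮⇒≥ λ lt → ℕ.<⇒≱ (emb<y⇒ lt) (open-below k (emb<y⇒ (subst (toℕ (emb k) <_) (sym y≡) z<y))))

  remove : ∀ {p} → Matching (suc h) p → p y ≡ x → Σ (Fin m → Fin m) (Removal p)
  remove {p} μ p-y = (λ k → proj₁ (q k)) , record { p-y = p-y ; p-x = p-x ; p-emb = λ k → proj₂ (q k) }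
    where
    open Matching μ
    p-x : p x ≡ y
    p-x = trans (cong p (sym p-y)) (involutive y)
    from-view : ∀ k {z} → View z → p (emb k) ≡ z → Σ (Fin m) λ k' → p (emb k) ≡ emb k'
    from-view k at-x eq = contradiction (trans (sym (involutive (emb k))) (trans (cong p eq) p-x)) emb≢y
    from-view k at-y eq = contradiction (trans (sym (involutive (emb k))) (trans (cong p eq) p-y)) emb≢x
    from-view k (at-emb k') eq = k' , eq
    q : ∀ k → Σ (Fin m) λ k' → p (emb k) ≡ emb k'
    q k = from-view k (view (p (emb k))) refl

  module Weights (P : Partner (suc (suc m))) (Q : Partner m) (ρ : Removal (lookup P) (lookup Q)) (μ : Matching h (lookup Q)) where
    open Removal ρ
    open Matching μ
    private
      p = lookup P
      q = lookup Q

    far : ∀ k → toℕ k < h → toℕ y < toℕ (emb (q k))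
    far k k<h = ℕ.≤∧≢⇒< (ℕ.≮⇒≥ λ lt → ℕ.<⇒≱ (emb<y⇒ lt) (open-below k k<h)) (λ eq → emb≢y (sym (toℕ-injective eq)))

    left-end : ∀ k → isLeftEnd P (emb k) ≡ isLeftEnd Q k
    left-end k = trans (cong (emb k <F_) (p-emb k)) (emb-<ᵇ k (q k))

    skip₂ : ∀ {a b c c'} → a ≡ 0 → b ≡ 0 → c ≡ c' → a + (b + c) ≡ c'
    skip₂ refl refl eq = eq

    -- `y` is the first point at which an edge closes, so the removed edge ends before every other.
    -- An edge is counted among the crossings or nestings of another only if it ends later; so the
    -- removal changes neither number for the remaining edges.
    cross-emb : ∀ k → T (isLeftEnd Q k) → crossAt P (emb k) ≡ crossAt Q k
    cross-emb k left = trans (∑-split (crossTerm P (emb k))) (skip₂ (𝟙-false at-y-no) (𝟙-false at-x-no) (∑-cong λ l → cong 𝟙[_] (emb-yes l)))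
      where
      at-y-no : ¬ T ((emb k <F y) ∧ (y <F p (emb k)) ∧ (p (emb k) <F p y))
      at-y-no t with ∧-elim {emb k <F y} t
      ... | _ , t' with ∧-elim {y <F p (emb k)} t'
      ... | y<e , e<x rewrite p-y = ℕ.<-asym x<y (ℕ.<-trans (<ᵇ→< y<e) (<ᵇ→< e<x))
      at-x-no : ¬ T ((emb k <F x) ∧ (x <F p (emb k)) ∧ (p (emb k) <F p x))
      at-x-no t with ∧-elim {emb k <F x} t
      ... | k<x , t' with ∧-elim {x <F p (emb k)} t'
      ... | _ , e<y rewrite p-x | p-emb k = ℕ.<-asym (<ᵇ→< e<y) (far k (emb<y⇒ (ℕ.<-trans (<ᵇ→< k<x) x<y)))
      emb-yes : ∀ l → (emb k <F emb l) ∧ (emb l <F p (emb k)) ∧ (p (emb k) <F p (emb l))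
        ≡ (k <F l) ∧ (l <F q k) ∧ (q k <F q l)
      emb-yes l rewrite p-emb k | p-emb l = cong₂ _∧_ (emb-<ᵇ k l) (cong₂ _∧_ (emb-<ᵇ l (q k)) (emb-<ᵇ (q k) (q l)))

    nest-emb : ∀ k → T (isLeftEnd Q k) → nestAt P (emb k) ≡ nestAt Q k
    nest-emb k left = trans (∑-split (nestTerm P (emb k))) (skip₂ (𝟙-false at-y-no) (𝟙-false at-x-no) (∑-cong λ l → cong 𝟙[_] (emb-yes l)))
      where
      k<qk : toℕ (emb k) < toℕ (emb (q k))
      k<qk = <ᵇ→< (subst T (sym (emb-<ᵇ k (q k))) left)
      at-y-no : ¬ T ((y <F emb k) ∧ (p (emb k) <F p y))
      at-y-no t with ∧-elim {y <F emb k} t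
      ... | y<k , e<x rewrite p-y | p-emb k = ℕ.<-asym x<y (ℕ.<-trans (<ᵇ→< y<k) (ℕ.<-trans k<qk (<ᵇ→< e<x)))
      at-x-no : ¬ T ((x <F emb k) ∧ (p (emb k) <F p x))
      at-x-no t with ∧-elim {x <F emb k} t
      ... | _ , e<y rewrite p-x | p-emb k = ℕ.<-asym (<ᵇ→< e<y) (far k (emb<y⇒ (ℕ.<-trans k<qk (<ᵇ→< e<y))))
      emb-yes : ∀ l → (emb l <F emb k) ∧ (p (emb k) <F p (emb l)) ≡ (l <F k) ∧ (q k <F q l)
      emb-yes l rewrite p-emb k | p-emb l = cong₂ _∧_ (emb-<ᵇ l k) (emb-<ᵇ (q k) (q l))

    -- The other h open edges all end after `y`. Those opened after `x` cross the edge, those opened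
    -- before `x` nest it, and `x'` is the number of the latter.
    cross-x : crossAt P x ≡ h ∸ toℕ x'
    cross-x = trans (∑-split (crossTerm P x)) (skip₂ (𝟙-false at-y-no) (𝟙-false at-x-no)
      (trans (∑-cong λ l → cong 𝟙[_] (emb-yes l)) (∑-between (toℕ x') h h≤m)))
      where
      at-y-no : ¬ T ((x <F y) ∧ (y <F p x) ∧ (p x <F p y))
      at-y-no t with ∧-elim {y <F p x} (proj₂ (∧-elim {x <F y} t))
      ... | y<y , _ rewrite p-x = ℕ.<-irrefl {toℕ y} refl (<ᵇ→< y<y)
      at-x-no : ¬ T ((x <F x) ∧ (x <F p x) ∧ (p x <F p x))
      at-x-no t = ℕ.<-irrefl {toℕ x} refl (<ᵇ→< (proj₁ (∧-elim {x <F x} t)))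
      emb-yes : ∀ l → (x <F emb l) ∧ (emb l <F p x) ∧ (p x <F p (emb l)) ≡ (toℕ x' <ᵇ suc (toℕ l)) ∧ (toℕ l <ᵇ h)
      emb-yes l rewrite p-x | p-emb l = cong₂ _∧_ (x-<ᵇ-emb l)
        (trans (∧-absorbʳ λ t → ℕ.<⇒<ᵇ (far l (emb<y⇒ (<ᵇ→< t)))) (emb-<ᵇ-y l))

    nest-x : nestAt P x ≡ toℕ x'
    nest-x = trans (∑-split (nestTerm P x)) (skip₂ (𝟙-false at-y-no) (𝟙-false at-x-no)
      (trans (∑-cong λ l → cong 𝟙[_] (emb-yes l)) (∑-< (toℕ x') (ℕ.≤-trans x'≤h h≤m))))
      where
      at-y-no : ¬ T ((y <F x) ∧ (p x <F p y))
      at-y-no t = ℕ.<-asym x<y (<ᵇ→< (proj₁ (∧-elim {y <F x} t)))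
      at-x-no : ¬ T ((x <F x) ∧ (p x <F p x))
      at-x-no t = ℕ.<-irrefl {toℕ x} refl (<ᵇ→< (proj₁ (∧-elim {x <F x} t)))
      emb-yes : ∀ l → (emb l <F x) ∧ (p x <F p (emb l)) ≡ (toℕ l <ᵇ toℕ x')
      emb-yes l rewrite p-x | p-emb l = trans
        (∧-absorbʳ λ t → ℕ.<⇒<ᵇ (far l (emb<y⇒ (ℕ.<-trans (<ᵇ→< t) x<y)))) (emb-<ᵇ-x l)

    left-x : T (isLeftEnd P x)
    left-x rewrite p-x = ℕ.<⇒<ᵇ x<y

    left-y : ¬ T (isLeftEnd P y)
    left-y rewrite p-y = λ t → ℕ.<-asym x<y (<ᵇ→< t)

    fcross : ℕ → ℕ → ℕ
    fcross c d = if 0 <ᵇ d then c else ⌊ c /2⌋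

    matchingWt-split : matchingWt P ≡ edgeWt (h ∸ toℕ x') (toℕ x') ⊕ matchingWt Q
    matchingWt-split = cong-⟨⟩
      (trans (∑-split (λ i → if isLeftEnd P i then fcrossAt P i else 0)) (skip-y (if-false left-y) (trans (if-true left-x) (cong₂ fcross cross-x nest-x))
        (∑-cong λ k → if-cong (left-end k) λ l → cong₂ fcross (cross-emb k l) (nest-emb k l))))
      (trans (∑-split (λ i → 𝟙[ isLeftEnd P i ∧ (crossAt P i <ᵇ nestAt P i) ])) (skip-y (𝟙-false λ t → left-y (proj₁ (∧-elim {isLeftEnd P y} t))) (cong 𝟙[_] (trans (∧-trueˡ left-x) (cong₂ _<ᵇ_ cross-x nest-x)))
        (∑-cong λ k → cong 𝟙[_] (∧-congʳ-T (left-end k) λ l → cong₂ _<ᵇ_ (cross-emb k l) (nest-emb k l)))))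
      (trans (∑-split (λ i → 𝟙[ isLeftEnd P i ∧ (nestAt P i <ᵇ crossAt P i) ])) (skip-y (𝟙-false λ t → left-y (proj₁ (∧-elim {isLeftEnd P y} t))) (cong 𝟙[_] (trans (∧-trueˡ left-x) (cong₂ _<ᵇ_ nest-x cross-x)))
        (∑-cong λ k → cong 𝟙[_] (∧-congʳ-T (left-end k) λ l → cong₂ _<ᵇ_ (nest-emb k l) (cross-emb k l)))))
      where
      skip-y : ∀ {a b b' c c'} → a ≡ 0 → b ≡ b' → c ≡ c' → a + (b + c) ≡ b' + c'
      skip-y refl refl refl = refl
      if-true : ∀ {b} {u v : ℕ} → T b → (if b then u else v) ≡ u
      if-true {true} _ = refl
      if-false : ∀ {b} {u v : ℕ} → ¬ T b → (if b then u else v) ≡ v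
      if-false {false} _ = refl
      if-false {true} h = ⊥-elim (h tt)
      ∧-trueˡ : ∀ {b c} → T b → b ∧ c ≡ c
      ∧-trueˡ {true} _ = refl

-- Reading a matching from left to right

lookup-ext : ∀ {A : Set} {n} {xs ys : Vec A n} → (∀ i → lookup xs i ≡ lookup ys i) → xs ≡ ys
lookup-ext {xs = xs} {ys} eq = trans (sym (tabulate∘lookup xs)) (trans (tabulate-cong eq) (tabulate∘lookup ys))

opens : ∀ {m} → ℕ → Partner m → Bool
opens h p = allF (λ i → (toℕ i <ᵇ h) ⇒ᵇ not (toℕ (lookup p i) <ᵇ h))

isOpenMatching : ∀ {m} → ℕ → Partner m → Bool
isOpenMatching h p = isPerfectMatching p ∧ opens h p

-- The state of the reading: closed edges have been deleted, the first `h` points are the left ends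
-- of the open edges, and the other m - h points are unread.
Open : ℕ → ℕ → WSet
Open m h = filter (Partner m) (isOpenMatching h) matchingWt

open⇒Matching : ∀ {m} h (p : Partner m) → T (isOpenMatching h p) → Matching h (lookup p)
open⇒Matching h p t = record
  { involutive = λ i → toℕ-injective (ℕ.≡ᵇ⇒≡ _ _ (proj₁ (at i)))
  ; irreflexive = λ i eq → not-elim (proj₂ (at i)) (ℕ.≡⇒≡ᵇ _ _ (cong toℕ eq))
  ; open-below = λ i i<h → ℕ.≮⇒≥ λ lt → not-elim
      (⇒ᵇ-elim (allF-elim (λ i → (toℕ i <ᵇ h) ⇒ᵇ not (toℕ (lookup p i) <ᵇ h)) (proj₂ t') i) (ℕ.<⇒<ᵇ i<h)) (ℕ.<⇒<ᵇ lt) }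
  where
  t' = ∧-elim {isPerfectMatching p} t
  at : ∀ i → T (lookup p (lookup p i) ≡F i) × T (not (lookup p i ≡F i))
  at i = ∧-elim {lookup p (lookup p i) ≡F i} (allF-elim (λ i → (lookup p (lookup p i) ≡F i) ∧ not (lookup p i ≡F i)) (proj₁ t') i)

Matching⇒open : ∀ {m} h (p : Partner m) → Matching h (lookup p) → T (isOpenMatching h p)
Matching⇒open h p μ = ∧-intro {isPerfectMatching p}
  (allF-intro (λ i → (lookup p (lookup p i) ≡F i) ∧ not (lookup p i ≡F i)) λ i →
    ∧-intro {lookup p (lookup p i) ≡F i} (ℕ.≡⇒≡ᵇ _ _ (cong toℕ (involutive i)))
      (not-intro λ t → irreflexive i (toℕ-injective (ℕ.≡ᵇ⇒≡ _ _ t))))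
  (allF-intro (λ i → (toℕ i <ᵇ h) ⇒ᵇ not (toℕ (lookup p i) <ᵇ h)) λ i →
    ⇒ᵇ-intro λ t → not-intro λ t' → ℕ.<⇒≱ (<ᵇ→< t') (open-below i (<ᵇ→< t)))
  where open Matching μ

-- No earlier point can be matched with `y`, since `y` would then close its edge; so the edges open
-- before `y` stay open beyond it.
Matching-open : ∀ {m h} {p : Fin m → Fin m} y → toℕ y ≡ h → Matching h p → ¬ (toℕ (p y) < toℕ y) → Matching (suc h) p
Matching-open {p = p} y refl μ y≤py = record
  { involutive = involutive
  ; irreflexive = irreflexive
  ; open-below = opn }
  where
  open Matching μ
  opn : ∀ i → toℕ i < suc (toℕ y) → toℕ y < toℕ (p i)
  opn i i≤y with i ≟ y
  ... | yes refl = ℕ.≤∧≢⇒< (ℕ.≮⇒≥ y≤py) (λ eq → irreflexive y (sym (toℕ-injective eq)))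
  ... | no i≢y = ℕ.≤∧≢⇒< (open-below i i<y) λ eq →
      y≤py (subst (λ z → toℕ z < toℕ y) (trans (sym (involutive i)) (cong p (sym (toℕ-injective eq)))) i<y)
    where
    i<y : toℕ i < toℕ y
    i<y = ℕ.≤∧≢⇒< (s≤s⁻¹ i≤y) (i≢y ∘ toℕ-injective)

Matching-weaken : ∀ {m h} {p : Fin m → Fin m} → Matching (suc h) p → Matching h p
Matching-weaken μ = record
  { involutive = involutive
  ; irreflexive = irreflexive
  ; open-below = λ i lt → ℕ.<⇒≤ (open-below i (ℕ.m<n⇒m<1+n lt)) }
  where open Matching μ

opening : ∀ {m h} (y : Fin m) → toℕ y ≡ h →
  filter (Partner m) (λ p → isOpenMatching h p ∧ not (lookup p y <F y)) matchingWt ≃ Open m (suc h)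
opening {h = h} y refl = filter-cong
  (λ p t → let μ , y≤ = ∧-elim {isOpenMatching h p} t in
    Matching⇒open (suc h) p (Matching-open y refl (open⇒Matching h p μ) (not-elim y≤ ∘ ℕ.<⇒<ᵇ)))
  (λ p t → let μ = open⇒Matching (suc h) p t in ∧-intro {isOpenMatching h p}
    (Matching⇒open h p (Matching-weaken μ))
    (not-intro λ lt → ℕ.<-asym (<ᵇ→< lt) (Matching.open-below μ y ℕ.≤-refl)))
  (λ _ _ → refl)

module _ {m h} (h≤m : h ≤ m) (y : Fin (suc (suc m))) (y≡ : toℕ y ≡ suc h) where
  private
    x' : Fin (suc h) → Fin (suc m)
    x' i = inject≤ i (s≤s h≤m)

    x'≡ : ∀ i → toℕ (x' i) ≡ toℕ i
    x'≡ i = toℕ-inject≤ i (s≤s h≤m)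

    x'≤h : ∀ i → toℕ (x' i) ≤ h
    x'≤h i = subst (_≤ h) (sym (x'≡ i)) (s≤s⁻¹ (toℕ<n i))

    module Rm i = Remove h≤m y y≡ (x' i) (x'≤h i)

    Closing : Partner (suc (suc m)) → Fin (suc h) → Partner m → Set
    Closing p i q = Rm.Removal i (lookup p) (lookup q)

    isClosing : Partner (suc (suc m)) → Bool
    isClosing p = isOpenMatching (suc h) p ∧ (lookup p y <F y)

    close : ∀ p → T (isClosing p) → Σ (Fin (suc h)) λ i → Σ (Partner m) λ q → T (isOpenMatching h q) × Closing p i q
    close p t = i , tabulate (proj₁ r) , Matching⇒open h (tabulate (proj₁ r)) (Rm.removed-Matching i ρ μ) , ρ
      where
      t' = ∧-elim {isOpenMatching (suc h) p} t
      μ = open⇒Matching (suc h) p (proj₁ t')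
      py<1+h : toℕ (lookup p y) < suc h
      py<1+h = subst (toℕ (lookup p y) <_) y≡ (<ᵇ→< (proj₂ t'))
      i = fromℕ< py<1+h
      p-y : lookup p y ≡ Rm.x i
      p-y = toℕ-injective (sym (trans (Rm.x≡ i) (trans (x'≡ i) (toℕ-fromℕ< py<1+h))))
      r = Rm.remove i μ p-y
      ρ : Closing p i (tabulate (proj₁ r))
      ρ = record
        { p-y = Rm.Removal.p-y (proj₂ r)
        ; p-x = Rm.Removal.p-x (proj₂ r)
        ; p-emb = λ k → trans (Rm.Removal.p-emb (proj₂ r) k) (cong (Rm.emb i) (sym (lookup∘tabulate (proj₁ r) k))) }

    unclose : ∀ i q → T (isOpenMatching h q) → Σ (Partner (suc (suc m))) λ p → T (isClosing p) × Closing p i q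
    unclose i q t = p , ∧-intro {isOpenMatching (suc h) p}
        (Matching⇒open (suc h) p (Rm.inserted-Matching i ρ (open⇒Matching h q t)))
        (subst (λ z → T (z <F y)) (sym (Rm.Removal.p-y ρ)) (ℕ.<⇒<ᵇ (Rm.x<y i))) , ρ
      where
      p = tabulate (Rm.insert i (lookup q))
      ρ' = Rm.insert-Removal i (lookup q)
      l = lookup∘tabulate (Rm.insert i (lookup q))
      ρ : Closing p i q
      ρ = record
        { p-y = trans (l y) (Rm.Removal.p-y ρ')
        ; p-x = trans (l (Rm.x i)) (Rm.Removal.p-x ρ')
        ; p-emb = λ k → trans (l (Rm.emb i k)) (Rm.Removal.p-emb ρ' k) }

    Closing-unique : ∀ p i q i' q' → Closing p i q → Closing p i' q' → (i , q) ≡ (i' , q')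
    Closing-unique p i q i' q' ρ ρ' with
      toℕ-injective {i = i} {i'} (trans (sym (x'≡ i)) (trans (cong toℕ (punchIn-injective y (x' i) (x' i')
        (trans (sym (Rm.Removal.p-y ρ)) (Rm.Removal.p-y ρ')))) (x'≡ i')))
    ... | refl = cong (i ,_) (lookup-ext (Rm.unique-q i {lookup p} ρ ρ'))

  -- The index `i` is the position of the partner of `y` among the h + 1 open points, and so the
  -- number of nestings of the closed edge.
  closing : filter (Partner (suc (suc m))) isClosing matchingWt ≃
    ⨁ (Fin (suc h)) (λ i → single (edgeWt (h ∸ toℕ i) (toℕ i)) ⊠ Open m h)
  closing = record
    { to = λ (p , t) → let i , q , t' , _ = close p t in i , tt , q , t'
    ; from = λ (i , _ , q , t) → let p , t' , _ = unclose i q t in p , t'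
    ; to-from = λ (i , _ , q , t) → let p , t' , ρ = unclose i q t ; i' , q' , t'' , ρ' = close p t' in
        pair-≡ t'' t (Closing-unique p i' q' i q ρ' ρ)
    ; from-to = λ (p , t) → let i , q , t' , ρ = close p t ; p' , t'' , ρ' = unclose i q t' in
        filter-≡ (lookup-ext (Rm.unique-p i {lookup p'} {lookup p} {lookup q} ρ' ρ))
    ; wt-to = λ (p , t) → let i , q , t' , ρ = close p t in
        sym (trans (Rm.Weights.matchingWt-split i p q ρ (open⇒Matching h q t'))
          (cong (λ j → edgeWt (h ∸ j) j ⊕ matchingWt q) (x'≡ i))) }
    where
    pair-≡ : ∀ {i i' q q'} t t' → (i , q) ≡ (i' , q') →
      _≡_ {A = Elem (⨁ (Fin (suc h)) (λ i → single (edgeWt (h ∸ toℕ i) (toℕ i)) ⊠ Open m h))} (i , tt , q , t) (i' , tt , q' , t')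
    pair-≡ {i} t t' refl = cong (λ o → i , tt , o) (filter-≡ refl)

-- From edges to down-step weights, and the final bijection

q^≃ : ∀ n → 𝐪 ^ n ≃ single ⟨ n , 0 , 0 ⟩
q^≃ zero = ≃-refl
q^≃ (suc n) = ≃-trans (⊠-cong ≃-refl (q^≃ n)) (≃-sym (single-⊕ ⟨ 1 , 0 , 0 ⟩ ⟨ n , 0 , 0 ⟩))

edge≃ : ∀ c d → edge c d ≃ single (edgeWt c d)
edge≃ c d = ≃-trans (⊠-cong (q^≃ e) (⊠-cong (α≃ (c <ᵇ d)) (γ≃ (d <ᵇ c))))
  (≃-trans (⊠-cong (≃-refl {single ⟨ e , 0 , 0 ⟩}) (≃-sym (single-⊕ u v)))
  (≃-trans (≃-sym (single-⊕ ⟨ e , 0 , 0 ⟩ (u ⊕ v))) (≃-reflexive (cong single (cong-⟨⟩ (ℕ.+-identityʳ e) (ℕ.+-identityʳ _) refl)))))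
  where
  e = if 0 <ᵇ d then c else ⌊ c /2⌋
  u = ⟨ 0 , 𝟙[ c <ᵇ d ] , 0 ⟩
  v = ⟨ 0 , 0 , 𝟙[ d <ᵇ c ] ⟩
  α≃ : ∀ b → (if b then 𝐚 else 𝟙) ≃ single ⟨ 0 , 𝟙[ b ] , 0 ⟩
  α≃ true = ≃-refl
  α≃ false = ≃-refl
  γ≃ : ∀ b → (if b then 𝐠 else 𝟙) ≃ single ⟨ 0 , 0 , 𝟙[ b ] ⟩
  γ≃ true = ≃-refl
  γ≃ false = ≃-refl

-- The order is reversed because the index counts nestings, whereas the sum in `lam` runs over
-- crossings.
⨁-Fin : ∀ n f → ⨁ (Fin n) (λ i → f (n ∸ suc (toℕ i))) ≃ sumTo n f
⨁-Fin zero f = empty (λ ()) (λ ())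
⨁-Fin (suc n) f = ≃-trans split (≃-trans (⊞-comm _ _) (⊞-cong (⨁-Fin n f) ≃-refl))
  where
  split : ⨁ (Fin (suc n)) (λ i → f (n ∸ toℕ i)) ≃ f n ⊞ ⨁ (Fin n) (λ i → f (n ∸ suc (toℕ i)))
  split = record
    { to = λ { (zero , z) → inj₁ z ; (suc i , z) → inj₂ (i , z) }
    ; from = λ { (inj₁ z) → zero , z ; (inj₂ (i , z)) → suc i , z }
    ; to-from = λ { (inj₁ _) → refl ; (inj₂ _) → refl }
    ; from-to = λ { (zero , _) → refl ; (suc _ , _) → refl }
    ; wt-to = λ { (zero , _) → refl ; (suc _ , _) → refl } }

⨁-edges : ∀ h X → ⨁ (Fin (suc h)) (λ i → single (edgeWt (h ∸ toℕ i) (toℕ i)) ⊠ X) ≃ lam h ⊠ X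
⨁-edges h X = ≃-trans (⨁-cong λ i → ⊠-comm _ X) (≃-trans (⨁-⊠ X (λ i → single (edgeWt (h ∸ toℕ i) (toℕ i))))
  (≃-trans (⊠-comm X _) (⊠-cong sum≃ ≃-refl)))
  where
  sum≃ : ⨁ (Fin (suc h)) (λ i → single (edgeWt (h ∸ toℕ i) (toℕ i))) ≃ lam h
  sum≃ = ≃-trans (⨁-cong λ i → ≃-trans
      (≃-reflexive (cong (λ d → single (edgeWt (h ∸ toℕ i) d)) (sym (ℕ.m∸[m∸n]≡n (s≤s⁻¹ (toℕ<n i))))))
      (≃-sym (edge≃ (h ∸ toℕ i) (h ∸ (h ∸ toℕ i)))))
    (⨁-Fin (suc h) (λ c → edge c (h ∸ c)))

-- `N` counts the unread points. Opening an edge leaves `m` fixed and raises `h`; closing one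
-- deletes a left end together with the point read, so `m` drops by two while `N` drops by one.
Open≃dyck : ∀ N {m} h → h + N ≡ m → Open m h ≃ dyck N h
Open≃dyck zero zero refl = record
  { to = λ _ → tt ; from = λ _ → [] , tt ; to-from = λ _ → refl ; from-to = λ { ([] , _) → refl } ; wt-to = λ { ([] , _) → refl } }
-- No point is left at which the open edges could close.
Open≃dyck zero (suc h) refl = empty
  (λ (p , t) → ℕ.<⇒≱ (toℕ<n (lookup p zero)) (subst (_≤ toℕ (lookup p zero)) (cong suc (sym (ℕ.+-identityʳ h)))
    (Matching.open-below (open⇒Matching (suc h) p t) zero (s≤s z≤n))))
  (λ ())
-- With no edge open, the next point can only open one: the conditions for 0 and for 1 open points
-- select the same matchings.
Open≃dyck (suc N) {suc m} zero eq = ≃-trans (filter-cong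
    (λ p t → Matching⇒open 1 p (Matching-open zero refl (open⇒Matching 0 p t) λ ()))
    (λ p t → Matching⇒open 0 p (Matching-weaken (open⇒Matching 1 p t)))
    (λ _ _ → refl))
  (Open≃dyck N 1 eq)
Open≃dyck (suc N) {zero} (suc h) ()
Open≃dyck (suc N) {suc zero} (suc h) eq = contradiction (trans (sym (ℕ.+-suc h N)) (ℕ.suc-injective eq)) λ ()
Open≃dyck (suc N) {suc (suc m)} (suc h) eq = ≃-trans (filter-split (isOpenMatching (suc h)) (λ p → lookup p y <F y) matchingWt)
  (⊞-cong
    (≃-trans (opening y y≡) (Open≃dyck N (suc (suc h)) (trans (cong suc (sym (ℕ.+-suc h N))) eq)))
    (≃-trans (closing h≤m y y≡) (≃-trans (⨁-edges h (Open m h)) (⊠-cong ≃-refl (Open≃dyck N h h+N≡m)))))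
  where
  h+N≡m : h + N ≡ m
  h+N≡m = ℕ.suc-injective (trans (sym (ℕ.+-suc h N)) (ℕ.suc-injective eq))
  h≤m : h ≤ m
  h≤m = ℕ.m+n≤o⇒m≤o h (ℕ.≤-reflexive h+N≡m)
  y< : suc h < suc (suc m)
  y< = s≤s (s≤s h≤m)
  y = fromℕ< y<
  y≡ = toℕ-fromℕ< y<

tableauWt : ∀ {n} → Filling n → Weight
tableauWt t = ⟨ qCount t , alphaCount t , gammaCount t ⟩

tableaux≃tab : ∀ n → filter (Filling n) (λ t → isStaircase t ∧ noDelta t) tableauWt ≃ tab n (λ _ → 𝟙)
tableaux≃tab n = begin
  filter (Filling n) (λ t → isStaircase t ∧ noDelta t) tableauWt
    ≈⟨ filter-cong (λ t p → Valid⇒valid ℕ.≤-refl t (staircase⇒Valid t p))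
         (λ t p → Valid⇒staircase t (valid⇒Valid t p)) (λ t p → sym (tableau-weight t p)) ⟩
  filter (Filling n) valid tabWt
    ≈⟨ filter-⨁ valid tabWt ⟩
  ⨁ (Filling n) (λ t → guard (valid t) ⊠ single (tabWt t))
    ≈⟨ ⨁-cong (λ t → ⊠-cong (≃-refl {guard (valid t)})
         (≃-trans (≃-sym (⊠-identityˡ _)) (⊠-comm 𝟙 (single (tabWt t))))) ⟩
  ⨁ (Filling n) (λ t → guard (valid t) ⊠ (single (tabWt t) ⊠ 𝟙))
    ≈⟨ ⨁-tableau ℕ.≤-refl (λ _ → 𝟙) ⟩
  tab n (λ _ → 𝟙) ∎

matchings≃dyck : ∀ m → filter (Partner m) isPerfectMatching matchingWt ≃ dyck m 0
matchings≃dyck m = ≃-trans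
  (filter-cong
    (λ p t → ∧-intro {isPerfectMatching p} t (allF-intro {m} (λ _ → true) λ _ → tt))
    (λ p t → proj₁ (∧-elim {isPerfectMatching p} t))
    (λ _ _ → refl))
  (Open≃dyck m 0 refl)

double-+2 : ∀ n → suc (suc (double n)) ≡ 2 * n + 2
double-+2 n = trans (cong (λ k → suc (suc k)) (trans (double≡+ n) (cong (n +_) (sym (ℕ.+-identityʳ n)))))
  (ℕ.+-comm 2 (2 * n))

tableaux≃matchings : ∀ n → filter (Filling n) (λ t → isStaircase t ∧ noDelta t) tableauWt
  ≃ filter (Partner (2 * n + 2)) isPerfectMatching matchingWt
tableaux≃matchings n = begin
  filter (Filling n) (λ t → isStaircase t ∧ noDelta t) tableauWt ≈⟨ tableaux≃tab n ⟩
  tab n (λ _ → 𝟙)                                          ≈⟨ tab≈dyck n ⟩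
  dyck (suc (suc (double n))) 0                            ≡⟨ cong (λ m → dyck m 0) (double-+2 n) ⟩
  dyck (2 * n + 2) 0                                       ≈⟨ matchings≃dyck (2 * n + 2) ⟨
  filter (Partner (2 * n + 2)) isPerfectMatching matchingWt ∎

theorem4p15 : (n : ℕ) →
    Σ (NoDeltaTableau n ⤖ PerfectMatching (2 * n + 2)) λ b →
    (t : NoDeltaTableau n) →
    let m = proj₁ (Bijection.to b t) in
    (totalFCross m ≡ qCount (proj₁ t))
    × (nestedEdges m ≡ alphaCount (proj₁ t))
    × (crossedEdges m ≡ gammaCount (proj₁ t))
theorem4p15 n = mk⤖ {to = to e} (injective , surjective) , λ t →
  cong Weight.q-exp (wt-to e t) , cong Weight.α-exp (wt-to e t) , cong Weight.γ-exp (wt-to e t)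
  where
  e : filter (Filling n) (λ t → isStaircase t ∧ noDelta t) tableauWt
    ≃ filter (Partner (2 * n + 2)) isPerfectMatching matchingWt
  e = tableaux≃matchings n
  injective : ∀ {s t} → to e s ≡ to e t → s ≡ t
  injective {s} {t} eq = trans (sym (from-to e s)) (trans (cong (from e) eq) (from-to e t))
  surjective : ∀ m → Σ (NoDeltaTableau n) λ t → ∀ {s} → s ≡ t → to e s ≡ m
  surjective m = from e m , λ { refl → to-from e m }
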